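{- Let $C_n(a,b)$ be a connected $2$-regular circulant digraph, let $l\ge1$, $0\le k\le l$ with $la+k(b-a)=\omega n$ for an integer $\omega$, and let $Q$ be the set of positive divisors of $\gcd(l,k)$ that are coprime with $\omega$. Then $$|\mathcal{P}_{l,k}(C_n(a,b))|=\frac{n}{l}\sum_{q\in Q}\ \sum_{m\mid \gcd(l,k)/q}\mu(m)\binom{l/(qm)}{k/(qm)},$$ where $\mu$ is the Möbius function.
   Context: Let $n\ge 2$ and $0<a<b<n$ be integers; $C_n(a,b)$ is connected iff $\gcd(n,a,b)=1$. $C_n(a,b)$ has vertex set $\mathbb{Z}_n$ and directed bonds $(v,v+a)$, $(v,v+b)$ (addition mod $n$), with step sizes $a$, $b$. A path of length $l$ is a sequence of bonds $(e_1,\dots,e_l)$ with the terminus of $e_j$ equal to the origin of $e_{j+1}$; its $b$-count is the number of bonds of step size $b$; a circuit is a path whose last terminus equals its first origin. A periodic orbit is an equivalence class of circuits under cyclic rotation $(e_1,\dots,e_l)\mapsto(e_2,\dots,e_l,e_1)$; it is primitive if it is not $[c_0^r]$ for a circuit $c_0$ and $r>1$ ($c_0^r$ = concatenation of $r$ copies). $\mathcal{P}_{l,k}(C_n(a,b))$ is the set of primitive periodic orbits of length $l$ and $b$-count $k$. -}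

module Defs where

open import Data.Bool.Base using (Bool; true; false; if_then_else_)
open import Data.Fin.Base using (Fin; toℕ)
open import Data.Integer.Base as ℤ using (ℤ; +_; 0ℤ; -1ℤ; ∣_∣)
open import Data.List.Base
  using (List; []; _∷_; _∷ʳ_; map; filter; filterᵇ; length; upTo; head; last; concat; replicate)
open import Data.List.Relation.Unary.Linked using (Linked)
import Data.Maybe.Base as Maybe
open import Data.Nat.Base
open import Data.Nat.Combinatorics using (_C_)
open import Data.Nat.Coprimality using (coprime?)
open import Data.Nat.Divisibility using (_∣?_)
open import Data.Nat.DivMod using (_/_; _mod_)
open import Data.Nat.GCD using (gcd)
open import Data.Nat.Primality.Factorisation using (factorise; factors)
open import Data.Nat.Properties using (_≟_; m*n≢0)
open import Data.List.Relation.Unary.Unique.DecPropositional _≟_ using (unique?)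
open import Data.Product.Base using (∃-syntax; _×_)
open import Function.Bundles using (Inverse)
open import Level using (0ℓ)
open import Relation.Binary.Bundles using (Setoid)
open import Relation.Binary.Construct.Closure.Equivalence as EqClosure using (EqClosure)
import Relation.Binary.Construct.On as On
open import Relation.Binary.PropositionalEquality using (_≡_)
import Relation.Binary.PropositionalEquality as ≡
open import Relation.Nullary using (¬_; does)

-- The setoid S, regarded as the quotient of its carrier, has N elements.
HasCardinality : Setoid 0ℓ 0ℓ → ℕ → Set
HasCardinality S N = Inverse S (≡.setoid (Fin N))

-- Because 0 < a < b < n in all uses, the bonds (v , v + a) and (v , v + b) are
-- distinct, so a bond is determined by its origin and which step it takes.
data Step : Set where
  a-step b-step : Step

module Circulant (n a b : ℕ) .{{_ : NonZero n}} where

  Vertex : Set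
  Vertex = Fin n

  record Bond : Set where
    constructor bond
    field
      origin : Vertex
      step   : Step

  open Bond public

  stepSize : Step → ℕ
  stepSize a-step = a
  stepSize b-step = b

  terminus : Bond → Vertex
  terminus e = (toℕ (origin e) + stepSize (step e)) mod n

  _⟶_ : Vertex → Vertex → Set
  u ⟶ v = ∃[ e ] origin e ≡ u × terminus e ≡ v

  -- Bonds may be traversed in either direction (weak connectedness).
  Connected : Set
  Connected = ∀ u v → EqClosure _⟶_ u v

  IsPath : List Bond → Set
  IsPath = Linked (λ e f → terminus e ≡ origin f)

  -- The empty path counts as a circuit here; its powers are empty, so this does
  -- not affect which orbits of positive length are primitive.
  IsCircuit : List Bond → Set
  IsCircuit c = IsPath c × Maybe.map terminus (last c) ≡ Maybe.map origin (head c)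

  isB : Bond → Bool
  isB (bond _ a-step) = false
  isB (bond _ b-step) = true

  bCount : List Bond → ℕ
  bCount c = length (filterᵇ isB c)

  rotate : List Bond → List Bond
  rotate []       = []
  rotate (e ∷ es) = es ∷ʳ e

  rotationSetoid : Setoid 0ℓ 0ℓ
  rotationSetoid = EqClosure.setoid (λ c d → rotate c ≡ d)

  open Setoid rotationSetoid public using () renaming (_≈_ to _∼_)

  _^^_ : List Bond → ℕ → List Bond
  c ^^ r = concat (replicate r c)

  IsPrimitive : List Bond → Set
  IsPrimitive c = ¬ (∃[ c₀ ] ∃[ r ] IsCircuit c₀ × r > 1 × c ∼ (c₀ ^^ r))

  record PrimitiveCircuit (l k : ℕ) : Set where
    field
      bonds       : List Bond
      isCircuit   : IsCircuit bonds
      length≡l    : length bonds ≡ l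
      bCount≡k    : bCount bonds ≡ k
      isPrimitive : IsPrimitive bonds

  -- 𝒫 l k: its elements up to setoid equality are the primitive periodic orbits.
  𝒫 : ℕ → ℕ → Setoid 0ℓ 0ℓ
  𝒫 l k = On.setoid rotationSetoid (PrimitiveCircuit.bonds {l} {k})

record ℕ⁺ : Set where
  constructor pos
  field
    value       : ℕ
    .{{value≢0}} : NonZero value

open ℕ⁺ public using (value)

∑ : List ℕ⁺ → ((d : ℕ) .{{_ : NonZero d}} → ℤ) → ℤ
∑ []           f = 0ℤ
∑ (pos d ∷ ds) f = f d ℤ.+ ∑ ds f

infixr 2 ∑
syntax ∑ ds (λ d → t) = ∑[ d ← ds ] t

-- Intended for g > 0, where every divisor lies in {1, …, g}.
divisors : ℕ → List ℕ⁺
divisors g = filter (λ d → value d ∣? g) (map (λ i → pos (suc i)) (upTo g))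

coprimeDivisors : ℕ → ℤ → List ℕ⁺
coprimeDivisors g ω = filter (λ q → coprime? (value q) ∣ ω ∣) (divisors g)

-- The Möbius function: the prime factors, listed with multiplicity, are distinct
-- exactly when m is squarefree.
μ : (m : ℕ) .{{_ : NonZero m}} → ℤ
μ m = if does (unique? ps) then -1ℤ ℤ.^ length ps else 0ℤ
  where ps = factors (factorise m)

_÷_·_ : ℕ → (q m : ℕ) .{{_ : NonZero q}} .{{_ : NonZero m}} → ℕ
j ÷ q · m = _/_ j (q * m) {{m*n≢0 q m}}

orbitSum : ℕ → ℕ → ℤ → ℤ
orbitSum l k ω =
  ∑[ q ← coprimeDivisors (gcd l k) ω ]
  ∑[ m ← divisors (gcd l k / q) ]
    μ m ℤ.* + ((l ÷ q · m) C (k ÷ q · m))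

{-# OPTIONS --safe #-}
module Submission where

open import Defs
open import Data.Bool.Base using (true; false; if_then_else_)
open import Data.Fin.Base using (Fin; zero; suc; toℕ)
import Data.Fin.Properties as Fin
open import Data.Integer.Base as ℤ using (ℤ; +_; 0ℤ; 1ℤ; -1ℤ)
import Data.Integer.Properties as ℤ
open import Data.Integer.Tactic.RingSolver using (solve-∀)
open import Data.List.Base
  using (List; []; _∷_; _∷ʳ_; _++_; map; filter; length; lookup; last; take; drop; concat; replicate;
         upTo; applyUpTo; allFin; cartesianProduct; deduplicate)
open import Data.List.Membership.Propositional using (_∈_; find; lose)
open import Data.List.Membership.Propositional.Properties
open import Data.List.Membership.Propositional.Properties.WithK using (unique∧set⇒bag)
import Data.List.Membership.Setoid as SetoidMembership
import Data.List.Membership.Setoid.Properties as SetoidMembershipₚ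
open import Data.List.Properties
  using (++-assoc; ++-identityʳ; ++-cancelˡ; length-++; length-map; length-take; length-tabulate;
         length-applyUpTo; map-++; take++drop≡id; ≡-dec; ∷-injectiveˡ; ∷-injectiveʳ)
open import Data.List.Relation.Binary.BagAndSetEquality using (∼bag⇒↭)
open import Data.List.Relation.Binary.Permutation.Propositional
  using (_↭_; refl; prep; swap; trans; ↭-refl; ↭-sym; ↭-trans; ↭⇒↭ₛ)
open import Data.List.Relation.Binary.Permutation.Propositional.Properties using (↭-length; ∷↭∷ʳ; map⁺)
open import Data.List.Relation.Binary.Permutation.Setoid.Properties using (Unique-resp-↭)
open import Data.List.Relation.Unary.All as All using (All; []; _∷_)
open import Data.List.Relation.Unary.All.Properties as Allₚ using (All¬⇒¬Any; ¬Any⇒All¬)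
open import Data.List.Relation.Unary.AllPairs as AllPairs using ([]; _∷_)
open import Data.List.Relation.Unary.Any as Any using (here; there)
import Data.List.Relation.Unary.Any.Properties as Anyₚ
open import Data.List.Relation.Unary.Linked using ([]; [-]; _∷_)
open import Data.List.Relation.Unary.Unique.DecSetoid.Properties using (deduplicate-!)
import Data.List.Relation.Unary.Unique.DecPropositional as UniqueDec
open import Data.List.Relation.Unary.Unique.Propositional using (Unique)
import Data.List.Relation.Unary.Unique.Propositional.Properties as Unique
import Data.List.Relation.Unary.Unique.Setoid as SetoidUnique
open import Data.Maybe.Base as Maybe using (just)
open import Data.Maybe.Properties using (just-injective)
open import Data.Nat.Base as ℕ hiding (_/_)
open import Data.Nat.Combinatorics using (_C_; nCk+nC[k+1]≡[n+1]C[k+1])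
open import Data.Nat.Coprimality using (Coprime; coprime?; coprime-divisor)
open import Data.Nat.Divisibility
open import Data.Nat.DivMod
  using (_mod_; m%n<n; m<n⇒m%n≡m; m%n%n≡m%n; m≡m%n+[m/n]*n; [m+kn]%n≡m%n; %-distribˡ-+; m*[n/m]≡n)
open import Data.Nat.GCD using (gcd; gcd[m,n]∣m; gcd[m,n]∣n; gcd-greatest; gcd-GCD; module Bézout)
open import Data.Nat.ListAction using (sum)
open import Data.Nat.ListAction.Properties using (sum-++; sum-↭; ∈⇒∣product)
open import Data.Nat.Primality using (Prime; prime⇒nonZero; prime⇒irreducible)
open import Data.Nat.Primality.Factorisation
open import Data.Nat.Properties
open import Data.Product.Base using (∃-syntax; _×_; _,_; proj₁; proj₂; uncurry)
open import Data.Rational.Base as ℚ using (_/_)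
import Data.Rational.Properties as ℚ
open import Data.Rational.Unnormalised.Base as ℚᵘ using (mkℚᵘ; *≡*)
import Data.Rational.Unnormalised.Properties as ℚᵘ
open import Data.Sum.Base using (inj₁; inj₂)
open import Function.Base using (_∘_; case_of_)
open import Function.Bundles using (mk⇔)
open import Level using (0ℓ)
open import Relation.Binary.Bundles using (DecSetoid; Setoid)
open import Relation.Binary.Construct.Closure.ReflexiveTransitive using (ε; _◅_)
open import Relation.Binary.Construct.Closure.Symmetric using (fwd; bwd)
import Relation.Binary.Construct.On as On
open import Relation.Binary.Definitions using (DecidableEquality) renaming (Decidable to Decidable₂)
open import Relation.Binary.PropositionalEquality as ≡
  using (_≡_; _≢_; refl; cong; cong₂; sym; subst; module ≡-Reasoning)
open import Relation.Nullary using (¬_; Dec; does; yes; no; ¬?; contradiction)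
open import Relation.Nullary.Decidable using (map′; does-⇔; dec-true; dec-false)
open import Relation.Unary using (Pred; Decidable)
open Circulant using (Connected; 𝒫)

-- A circuit with displacement ω n is a starting vertex together with a word w in the two
-- steps.  Write w = x^e with x not a proper power.  The roots of w are the powers x^(e/d)
-- with d ∣ e, and such a root closes up exactly when n divides ω n / d, that is when d ∣ ω;
-- so the circuit is primitive exactly when e is coprime to ω.  The words that are d-th
-- powers number (l/d choose k/d), and ∑ μ(m) over m ∣ e is [e = 1], so the double sum
-- counts the words of exponent coprime to ω.  A primitive circuit has l distinct
-- rotations, which gives l N = n · (double sum).

-- Finite sums of integers

-- The proof counts primitive circuits in two ways. A word with `l` steps, `k` of them b-steps, has
-- displacement `l a + k (b - a)`, a multiple of `n`, so it closes up from every vertex. Circuits of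
-- length `l` and b-count `k` are therefore pairs of one of `n` vertices and a word, and whether
-- such a circuit is primitive depends on the word alone: its exponent must be coprime to `ω`
-- (`isPrimitive⇒coprime`, `coprime⇒isPrimitive`). A primitive circuit has no period shorter than
-- `l` (`isPrimitive⇒aperiodic`), so each rotation class has exactly `l` members (`orbit-size`).
-- Hence `l N` is `n` times the number of words with exponent coprime to `ω`.
--
-- It remains to see that the double sum is this number of words. Periods of a word are closed under
-- gcd, so there is a period dividing all the others, and the word is a `d`-th power exactly when
-- `d` divides its exponent. Each binomial coefficient thus counts the words whose exponent is
-- divisible by `q m` (`count-powers`). Exchanging the sums and using that the Möbius function sums
-- to 0 over the divisors of any `e > 1` (`sum-μ`), the inner sum for fixed `q` counts the words of
-- exponent exactly `q` (`count-exponent`). The exponent always divides `gcd l k`, so summing over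
-- `q` in `Q` collects precisely the exponents coprime to `ω` (`orbitSum≡count`).

sumOver : {A : Set} → List A → (A → ℤ) → ℤ
sumOver []       f = 0ℤ
sumOver (x ∷ xs) f = f x ℤ.+ sumOver xs f

⟦_⟧ : {P : Set} → Dec P → ℤ
⟦ P? ⟧ = if does P? then 1ℤ else 0ℤ

⟦⟧-cong : {P Q : Set} → (P → Q) → (Q → P) → (P? : Dec P) (Q? : Dec Q) → ⟦ P? ⟧ ≡ ⟦ Q? ⟧
⟦⟧-cong to from P? Q? = cong (if_then 1ℤ else 0ℤ) (does-⇔ (mk⇔ to from) P? Q?)

⟦⟧-true : {P : Set} (P? : Dec P) → P → ⟦ P? ⟧ ≡ 1ℤ
⟦⟧-true P? p = cong (if_then 1ℤ else 0ℤ) (dec-true P? p)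

⟦⟧-false : {P : Set} (P? : Dec P) → ¬ P → ⟦ P? ⟧ ≡ 0ℤ
⟦⟧-false P? ¬p = cong (if_then 1ℤ else 0ℤ) (dec-false P? ¬p)

private
  variable
    A B : Set

sumOver-cong : (xs : List A) {f g : A → ℤ} → (∀ {x} → x ∈ xs → f x ≡ g x) → sumOver xs f ≡ sumOver xs g
sumOver-cong []       eq = refl
sumOver-cong (x ∷ xs) eq = cong₂ ℤ._+_ (eq (here refl)) (sumOver-cong xs (eq ∘ there))

sumOver-↭ : {xs ys : List A} (f : A → ℤ) → xs ↭ ys → sumOver xs f ≡ sumOver ys f
sumOver-↭ f refl         = refl
sumOver-↭ f (prep x p)   = cong (ℤ._+_ (f x)) (sumOver-↭ f p)
sumOver-↭ {xs = x ∷ y ∷ xs} {ys = _ ∷ _ ∷ ys} f (swap x y p) = begin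
  f x ℤ.+ (f y ℤ.+ sumOver xs f) ≡⟨ lemma (f x) (f y) (sumOver xs f) ⟩
  f y ℤ.+ (f x ℤ.+ sumOver xs f) ≡⟨ cong (λ s → f y ℤ.+ (f x ℤ.+ s)) (sumOver-↭ f p) ⟩
  f y ℤ.+ (f x ℤ.+ sumOver ys f) ∎
  where
  open ≡-Reasoning
  lemma : ∀ i j k → i ℤ.+ (j ℤ.+ k) ≡ j ℤ.+ (i ℤ.+ k)
  lemma = solve-∀
sumOver-↭ f (trans p q)  = ≡.trans (sumOver-↭ f p) (sumOver-↭ f q)

sumOver-++ : (xs ys : List A) (f : A → ℤ) → sumOver (xs ++ ys) f ≡ sumOver xs f ℤ.+ sumOver ys f
sumOver-++ []       ys f = sym (ℤ.+-identityˡ _)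
sumOver-++ (x ∷ xs) ys f = ≡.trans (cong (ℤ._+_ (f x)) (sumOver-++ xs ys f)) (sym (ℤ.+-assoc (f x) _ _))

sumOver-map : (g : B → A) (xs : List B) (f : A → ℤ) → sumOver (map g xs) f ≡ sumOver xs (f ∘ g)
sumOver-map g []       f = refl
sumOver-map g (x ∷ xs) f = cong (ℤ._+_ (f (g x))) (sumOver-map g xs f)

sumOver-+ : (xs : List A) (f g : A → ℤ) → sumOver xs (λ x → f x ℤ.+ g x) ≡ sumOver xs f ℤ.+ sumOver xs g
sumOver-+ []       f g = refl
sumOver-+ (x ∷ xs) f g = ≡.trans (cong (ℤ._+_ (f x ℤ.+ g x)) (sumOver-+ xs f g)) (lemma (f x) (g x) _ _)
  where
  lemma : ∀ i j k l → i ℤ.+ j ℤ.+ (k ℤ.+ l) ≡ i ℤ.+ k ℤ.+ (j ℤ.+ l)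
  lemma = solve-∀

sumOver-0 : (xs : List A) → sumOver xs (λ _ → 0ℤ) ≡ 0ℤ
sumOver-0 []       = refl
sumOver-0 (x ∷ xs) = ≡.trans (ℤ.+-identityˡ _) (sumOver-0 xs)

sumOver-*ˡ : (xs : List A) (c : ℤ) (f : A → ℤ) → sumOver xs (λ x → c ℤ.* f x) ≡ c ℤ.* sumOver xs f
sumOver-*ˡ []       c f = sym (ℤ.*-zeroʳ c)
sumOver-*ˡ (x ∷ xs) c f = ≡.trans (cong (ℤ._+_ (c ℤ.* f x)) (sumOver-*ˡ xs c f)) (sym (ℤ.*-distribˡ-+ c (f x) _))

sumOver-const : (xs : List A) (c : ℤ) → sumOver xs (λ _ → c) ≡ + length xs ℤ.* c
sumOver-const []       c = refl
sumOver-const (x ∷ xs) c = ≡.trans (cong (ℤ._+_ c) (sumOver-const xs c)) (sym (ℤ.suc-* (+ length xs) c))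

sumOver-swap : (xs : List A) (ys : List B) (f : A → B → ℤ) →
  sumOver xs (λ x → sumOver ys (f x)) ≡ sumOver ys (λ y → sumOver xs (λ x → f x y))
sumOver-swap []       ys f = sym (sumOver-0 ys)
sumOver-swap (x ∷ xs) ys f =
  ≡.trans (cong (ℤ._+_ (sumOver ys (f x))) (sumOver-swap xs ys f)) (sym (sumOver-+ ys _ _))

sumOver-filter : {P : Pred A 0ℓ} (P? : Decidable P) (xs : List A) (f : A → ℤ) →
  sumOver (filter P? xs) f ≡ sumOver xs (λ x → f x ℤ.* ⟦ P? x ⟧)
sumOver-filter P? []       f = refl
sumOver-filter P? (x ∷ xs) f with P? x
... | yes _ = cong₂ ℤ._+_ (sym (ℤ.*-identityʳ (f x))) (sumOver-filter P? xs f)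
... | no  _ = ≡.trans (sumOver-filter P? xs f)
  (sym (≡.trans (cong (ℤ._+ _) (ℤ.*-zeroʳ (f x))) (ℤ.+-identityˡ _)))

length-filter : {P : Pred A 0ℓ} (P? : Decidable P) (xs : List A) →
  + length (filter P? xs) ≡ sumOver xs (λ x → ⟦ P? x ⟧)
length-filter P? []       = refl
length-filter P? (x ∷ xs) with P? x
... | yes _ = cong (ℤ._+_ 1ℤ) (length-filter P? xs)
... | no  _ = ≡.trans (length-filter P? xs) (sym (ℤ.+-identityˡ _))

-- All multiplicities are 0 or 1, so equality as sets is equality as bags. The bijections between
-- enumerations below are all obtained in this way.
unique-↭ : {xs ys : List A} → Unique xs → Unique ys →
  (∀ {z} → z ∈ xs → z ∈ ys) → (∀ {z} → z ∈ ys → z ∈ xs) → xs ↭ ys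
unique-↭ xs! ys! ⊆ ⊇ = ∼bag⇒↭ (unique∧set⇒bag xs! ys! (mk⇔ ⊆ ⊇))

module _ (S : DecSetoid 0ℓ 0ℓ) where
  open DecSetoid S using (Carrier; setoid) renaming (_≟_ to _≈?_; trans to ≈-trans; sym to ≈-sym)
  open SetoidMembership setoid using () renaming (_∈_ to _∈ˢ_)
  open SetoidUnique setoid using () renaming (Unique to Uniqueˢ)

  -- A list without equivalent entries meets the class of `x` only once, so a single indicator is 1.
  sumOver-∈ : (x : Carrier) {ys : List Carrier} → Uniqueˢ ys → x ∈ˢ ys → sumOver ys (λ y → ⟦ x ≈? y ⟧) ≡ 1ℤ
  sumOver-∈ x {ys = y ∷ ys} (y∉ys ∷ ys!) (here x≈y) = cong₂ ℤ._+_ (⟦⟧-true (x ≈? y) x≈y)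
    (≡.trans (sumOver-cong ys λ {z} z∈ys → ⟦⟧-false (x ≈? z) λ x≈z → All.lookup y∉ys z∈ys (≈-trans (≈-sym x≈y) x≈z))
      (sumOver-0 ys))
  sumOver-∈ x {ys = y ∷ ys} (y∉ys ∷ ys!) (there x∈ys) = cong₂ ℤ._+_
    (⟦⟧-false (x ≈? y) λ x≈y → All¬⇒¬Any (All.map (λ ¬y≈z x≈z → ¬y≈z (≈-trans (≈-sym x≈y) x≈z)) y∉ys) x∈ys)
    (sumOver-∈ x ys! x∈ys)

  sumOver-∉ : (x : Carrier) (ys : List Carrier) → ¬ (x ∈ˢ ys) → sumOver ys (λ y → ⟦ x ≈? y ⟧) ≡ 0ℤ
  sumOver-∉ x []       x∉ys = refl
  sumOver-∉ x (y ∷ ys) x∉ys = cong₂ ℤ._+_ (⟦⟧-false (x ≈? y) (x∉ys ∘ here)) (sumOver-∉ x ys (x∉ys ∘ there))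

-- Divisors and the Möbius function

-- Packs the instance argument into `ℕ⁺`, so that `∑` comes under the lemmas on `sumOver`.
lift : ((d : ℕ) .{{_ : NonZero d}} → ℤ) → ℕ⁺ → ℤ
lift f (pos d) = f d

∑≡sumOver : (ds : List ℕ⁺) (f : (d : ℕ) .{{_ : NonZero d}} → ℤ) → ∑ ds f ≡ sumOver ds (lift f)
∑≡sumOver []           f = refl
∑≡sumOver (pos d ∷ ds) f = cong (ℤ._+_ (f d)) (∑≡sumOver ds f)

pos-cong : ∀ {c d} .{{_ : NonZero c}} .{{_ : NonZero d}} → c ≡ d → pos c ≡ pos d
pos-cong refl = refl

value-injective : ∀ {c d} → value c ≡ value d → c ≡ d
value-injective {pos _} {pos _} = pos-cong

∈-divisors⁻ : ∀ {g d} → d ∈ divisors g → value d ∣ g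
∈-divisors⁻ {g} = proj₂ ∘ ∈-filter⁻ (λ d → value d ∣? g) {xs = map (λ i → pos (suc i)) (upTo g)}

∈-divisors⁺ : ∀ {g} .{{_ : NonZero g}} {d} → value d ∣ g → d ∈ divisors g
∈-divisors⁺ {g} {pos (suc i)} d∣g =
  ∈-filter⁺ (λ d → value d ∣? g) (∈-map⁺ (λ i → pos (suc i)) (∈-upTo⁺ (∣⇒≤ d∣g))) d∣g

divisors-unique : ∀ g → Unique (divisors g)
divisors-unique g = Unique.filter⁺ (λ d → value d ∣? g)
  (Unique.map⁺ (λ eq → suc-injective (cong value eq)) (Unique.upTo⁺ g))

factors-prime-* : ∀ {p} (m : ℕ) .{{_ : NonZero m}} .{{_ : NonZero (p * m)}} → Prime p →
  factors (factorise (p * m)) ↭ p ∷ factors (factorise m)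
factors-prime-* {p} m p-prime = factorisationUnique (factorise (p * m)) record
  { factors         = p ∷ factors (factorise m)
  ; isFactorisation = cong (p *_) (PrimeFactorisation.isFactorisation (factorise m))
  ; factorsPrime    = p-prime ∷ PrimeFactorisation.factorsPrime (factorise m)
  }

module _ {p : ℕ} (p-prime : Prime p) (m : ℕ) .{{_ : NonZero m}} .{{_ : NonZero (p * m)}} where
  private
    ps = factors (factorise m)
    qs = factors (factorise (p * m))
    open UniqueDec _≟_ using (unique?)

    qs↭ : qs ↭ p ∷ ps
    qs↭ = factors-prime-* m p-prime

    p∈ps⇒p∣m : p ∈ ps → p ∣ m
    p∈ps⇒p∣m p∈ps = subst (p ∣_) (sym (PrimeFactorisation.isFactorisation (factorise m))) (∈⇒∣product p∈ps)

    p∣m⇒p∈ps : p ∣ m → p ∈ ps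
    p∣m⇒p∈ps p∣m = factorisationHasAllPrimeFactors p-prime
      (subst (p ∣_) (PrimeFactorisation.isFactorisation (factorise m)) p∣m)
      (PrimeFactorisation.factorsPrime (factorise m))

  -- The prime `p` already occurs among the factors of `m`, so it is repeated in `p * m`.
  μ-∣ : p ∣ m → μ (p * m) ≡ 0ℤ
  μ-∣ p∣m = cong (λ b → if b then -1ℤ ℤ.^ length qs else 0ℤ) (dec-false (unique? qs) λ qs! →
    case Unique-resp-↭ (≡.setoid ℕ) (↭⇒↭ₛ qs↭) qs! of λ where
      (p∉ps ∷ _) → All¬⇒¬Any p∉ps (p∣m⇒p∈ps p∣m))

  -- A new prime does not change whether the factors are distinct, and it lengthens their list by
  -- one.
  μ-∤ : ¬ p ∣ m → μ (p * m) ≡ ℤ.- μ m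
  μ-∤ p∤m = ≡.trans
    (cong₂ (λ b i → if b then i else 0ℤ) (does-⇔ (mk⇔ to from) (unique? qs) (unique? ps)) (cong (-1ℤ ℤ.^_) (↭-length qs↭)))
    (lemma (does (unique? ps)))
    where
    to : Unique qs → Unique ps
    to qs! = case Unique-resp-↭ (≡.setoid ℕ) (↭⇒↭ₛ qs↭) qs! of λ where (_ ∷ ps!) → ps!
    from : Unique ps → Unique qs
    from ps! = Unique-resp-↭ (≡.setoid ℕ) (↭⇒↭ₛ (↭-sym qs↭)) (¬Any⇒All¬ ps (p∤m ∘ p∈ps⇒p∣m) ∷ ps!)
    lemma : ∀ b → (if b then -1ℤ ℤ.^ suc (length ps) else 0ℤ) ≡ ℤ.- (if b then -1ℤ ℤ.^ length ps else 0ℤ)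
    lemma true  = ℤ.-1*i≡-i (-1ℤ ℤ.^ length ps)
    lemma false = refl

  -- Both cases in one formula, with an indicator, so that it can be summed over all divisors.
  μ-prime-* : μ (p * m) ≡ ℤ.- (μ m ℤ.* ⟦ ¬? (p ∣? m) ⟧)
  μ-prime-* with p ∣? m
  ... | yes p∣m = ≡.trans (μ-∣ p∣m) (cong ℤ.-_ (sym (ℤ.*-zeroʳ (μ m))))
  ... | no  p∤m = ≡.trans (μ-∤ p∤m) (cong ℤ.-_ (sym (ℤ.*-identityʳ (μ m))))

∃-primeDivisor : ∀ e .{{_ : NonTrivial e}} → ∃[ p ] Prime p × p ∣ e
∃-primeDivisor e@(2+ _) with factorise e
... | record { factors = [] ; isFactorisation = () }
... | record { factors = p ∷ ps ; isFactorisation = eq ; factorsPrime = p-prime ∷ _ } =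
  p , p-prime , subst (p ∣_) (sym eq) (m∣m*n _)

module _ {p : ℕ} (p-prime : Prime p) (e : ℕ) .{{_ : NonZero e}} where
  private
    instance
      _ = prime⇒nonZero p-prime
      _ = m*n≢0 p e

    p*_ : ℕ⁺ → ℕ⁺
    p* pos d = pos (p * d) {{m*n≢0 p d}}

    p∤? : Decidable (λ d → ¬ p ∣ value d)
    p∤? d = ¬? (p ∣? value d)

    p*-injective : ∀ {c d} → p* c ≡ p* d → c ≡ d
    p*-injective {pos c} {pos d} eq = pos-cong (*-cancelˡ-≡ c d p (cong value eq))

    p∤⇒coprime : ∀ {d} → ¬ p ∣ d → Coprime d p
    p∤⇒coprime p∤d (i∣d , i∣p) = case prime⇒irreducible p-prime i∣p of λ where
      (inj₁ i≡1)  → i≡1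
      (inj₂ refl) → contradiction i∣d p∤d

  -- A divisor of `p * e` prime to `p` divides `e`; any other one is `p * c`, and cancelling `p`
  -- leaves `c ∣ e`.
  divisors-prime-* : divisors (p * e) ↭ filter p∤? (divisors e) ++ map p*_ (divisors e)
  divisors-prime-* = unique-↭ (divisors-unique (p * e))
    (Unique.++⁺ (Unique.filter⁺ p∤? (divisors-unique e)) (Unique.map⁺ p*-injective (divisors-unique e)) disjoint)
    to from
    where
    disjoint : ∀ {d} → ¬ (d ∈ filter p∤? (divisors e) × d ∈ map p*_ (divisors e))
    disjoint (d∈ , d∈′) with ∈-map⁻ p*_ d∈′
    ... | pos c , _ , refl = proj₂ (∈-filter⁻ p∤? {xs = divisors e} d∈) (m∣m*n c)

    to : ∀ {d} → d ∈ divisors (p * e) → d ∈ filter p∤? (divisors e) ++ map p*_ (divisors e)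
    to {d} d∈ with p ∣? value d
    ... | no p∤d = ∈-++⁺ˡ (∈-filter⁺ p∤? (∈-divisors⁺ (coprime-divisor (p∤⇒coprime p∤d) (∈-divisors⁻ d∈))) p∤d)
    to {pos d} d∈ | yes (divides c refl) = ∈-++⁺ʳ _ (subst (_∈ map p*_ (divisors e))
      (pos-cong {{m*n≢0 p c}} (*-comm p c)) (∈-map⁺ p*_ (∈-divisors⁺ {d = pos c}
        (*-cancelˡ-∣ p (subst (_∣ p * e) (*-comm c p) (∈-divisors⁻ d∈))))))
      where instance _ = m*n≢0⇒m≢0 c {p}

    from : ∀ {d} → d ∈ filter p∤? (divisors e) ++ map p*_ (divisors e) → d ∈ divisors (p * e)
    from d∈ with ∈-++⁻ (filter p∤? (divisors e)) d∈
    ... | inj₁ d∈′ = ∈-divisors⁺ (∣n⇒∣m*n p (∈-divisors⁻ (proj₁ (∈-filter⁻ p∤? {xs = divisors e} d∈′))))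
    ... | inj₂ d∈′ with ∈-map⁻ p*_ d∈′
    ...   | pos c , c∈ , refl = ∈-divisors⁺ {{m*n≢0 p e}} (*-monoʳ-∣ p (∈-divisors⁻ c∈))

  -- The divisors d and p d of p e, with p ∤ d, cancel, and those p d with p ∣ d contribute 0.
  sum-μ-prime-* : sumOver (divisors (p * e)) (lift μ) ≡ 0ℤ
  sum-μ-prime-* = begin
    sumOver (divisors (p * e)) (lift μ)                   ≡⟨ sumOver-↭ (lift μ) divisors-prime-* ⟩
    sumOver (filter p∤? ds ++ map p*_ ds) (lift μ)        ≡⟨ sumOver-++ (filter p∤? ds) _ (lift μ) ⟩
    S ℤ.+ sumOver (map p*_ ds) (lift μ)                   ≡⟨ cong (ℤ._+_ S) (sumOver-map p*_ ds (lift μ)) ⟩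
    S ℤ.+ sumOver ds (λ d → lift μ (p* d))
      ≡⟨ cong (ℤ._+_ S) (sumOver-cong ds λ { {pos d} _ → μ-p* d {{pd = m*n≢0 p d}} }) ⟩
    S ℤ.+ sumOver ds (λ d → -1ℤ ℤ.* (lift μ d ℤ.* ⟦ p∤? d ⟧)) ≡⟨ cong (ℤ._+_ S) (sumOver-*ˡ ds -1ℤ _) ⟩
    S ℤ.+ -1ℤ ℤ.* sumOver ds (λ d → lift μ d ℤ.* ⟦ p∤? d ⟧)
      ≡⟨ cong (λ s → S ℤ.+ -1ℤ ℤ.* s) (sumOver-filter p∤? ds (lift μ)) ⟨
    S ℤ.+ -1ℤ ℤ.* S                                       ≡⟨ cong (ℤ._+_ S) (ℤ.-1*i≡-i S) ⟩
    S ℤ.- S                                               ≡⟨ ℤ.+-inverseʳ S ⟩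
    0ℤ                                                    ∎
    where
    open ≡-Reasoning
    ds = divisors e
    S = sumOver (filter p∤? ds) (lift μ)
    μ-p* : ∀ d .{{_ : NonZero d}} .{{pd : NonZero (p * d)}} →
      μ (p * d) ≡ -1ℤ ℤ.* (μ d ℤ.* ⟦ ¬? (p ∣? d) ⟧)
    μ-p* d = ≡.trans (μ-prime-* p-prime d) (sym (ℤ.-1*i≡-i _))

-- For `e > 1`, split off one prime factor; the cancellation in `sum-μ-prime-*` holds for every
-- nonzero cofactor.
sum-μ : ∀ e .{{_ : NonZero e}} → sumOver (divisors e) (lift μ) ≡ ⟦ e ≟ 1 ⟧
sum-μ 1 = refl
sum-μ e@(2+ _) with ∃-primeDivisor e
... | p , p-prime , divides c e≡c*p = ≡.trans
  (subst (λ m → sumOver (divisors m) (lift μ) ≡ 0ℤ) (≡.trans (*-comm p c) (sym e≡c*p)) (sum-μ-prime-* p-prime c))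
  (sym (⟦⟧-false (e ≟ 1) λ ()))
  where instance _ = m*n≢0⇒m≢0 c {p} {{≢-nonZero λ eq → case ≡.trans e≡c*p eq of λ ()}}

-- Rotations and powers of lists

-- Polymorphic counterpart of `rotate`, needed for words as well as for bonds; `rotate≡rot`
-- identifies the two.
rot : List A → List A
rot []       = []
rot (x ∷ xs) = xs ∷ʳ x

rot^ : ℕ → List A → List A
rot^ zero    xs = xs
rot^ (suc i) xs = rot^ i (rot xs)

_^ʷ_ : List A → ℕ → List A
xs ^ʷ r = concat (replicate r xs)

-- A cyclic period: 0 and the length always qualify, and `i` may exceed the length.
Period : List A → ℕ → Set
Period xs i = rot^ i xs ≡ xs

rot^-+ : ∀ i j (xs : List A) → rot^ (i + j) xs ≡ rot^ j (rot^ i xs)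
rot^-+ zero    j xs = refl
rot^-+ (suc i) j xs = rot^-+ i j (rot xs)

rot^-comm : ∀ i j (xs : List A) → rot^ i (rot^ j xs) ≡ rot^ j (rot^ i xs)
rot^-comm i j xs = ≡.trans (sym (rot^-+ j i xs)) (≡.trans (cong (λ m → rot^ m xs) (+-comm j i)) (rot^-+ i j xs))

rot^-++ : (xs ys : List A) → rot^ (length xs) (xs ++ ys) ≡ ys ++ xs
rot^-++ []       ys = sym (++-identityʳ ys)
rot^-++ (x ∷ xs) ys = begin
  rot^ (length xs) ((xs ++ ys) ∷ʳ x) ≡⟨ cong (rot^ (length xs)) (++-assoc xs ys (x ∷ [])) ⟩
  rot^ (length xs) (xs ++ ys ∷ʳ x)   ≡⟨ rot^-++ xs (ys ∷ʳ x) ⟩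
  ys ∷ʳ x ++ xs                      ≡⟨ ++-assoc ys (x ∷ []) xs ⟩
  ys ++ x ∷ xs                       ∎
  where open ≡-Reasoning

rot^-length : (xs : List A) → Period xs (length xs)
rot^-length xs = ≡.trans (cong (rot^ (length xs)) (sym (++-identityʳ xs))) (rot^-++ xs [])

rot^-↭ : ∀ i (xs : List A) → xs ↭ rot^ i xs
rot^-↭ zero    xs       = ↭-refl
rot^-↭ (suc i) []       = rot^-↭ i []
rot^-↭ (suc i) (x ∷ xs) = ↭-trans (∷↭∷ʳ x xs) (rot^-↭ i (xs ∷ʳ x))

length-rot^ : ∀ i (xs : List A) → length (rot^ i xs) ≡ length xs
length-rot^ i xs = sym (↭-length (rot^-↭ i xs))

rot-map : (f : A → B) (xs : List A) → map f (rot xs) ≡ rot (map f xs)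
rot-map f []       = refl
rot-map f (x ∷ xs) = map-++ f xs (x ∷ [])

rot^-map : ∀ (f : A → B) i (xs : List A) → map f (rot^ i xs) ≡ rot^ i (map f xs)
rot^-map f zero    xs = refl
rot^-map f (suc i) xs = ≡.trans (rot^-map f i (rot xs)) (cong (rot^ i) (rot-map f xs))

period-* : ∀ c {i} (xs : List A) → Period xs i → Period xs (c * i)
period-* zero        xs p = refl
period-* (suc c) {i} xs p =
  ≡.trans (rot^-+ i (c * i) xs) (≡.trans (cong (rot^ (c * i)) p) (period-* c xs p))

period-+⁻ : ∀ i j (xs : List A) → Period xs (i + j) → Period xs j → Period xs i
period-+⁻ i j xs pij pj = begin
  rot^ i xs           ≡⟨ cong (rot^ i) pj ⟨
  rot^ i (rot^ j xs)  ≡⟨ rot^-+ j i xs ⟨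
  rot^ (j + i) xs     ≡⟨ cong (λ m → rot^ m xs) (+-comm j i) ⟩
  rot^ (i + j) xs     ≡⟨ pij ⟩
  xs                  ∎
  where open ≡-Reasoning

-- By Bézout the gcd is a difference of multiples of `i` and `j`, and periods are closed under
-- multiples and differences.
period-gcd : ∀ {i j} (xs : List A) → Period xs i → Period xs j → Period xs (gcd i j)
period-gcd {i = i} {j} xs pi pj with Bézout.identity (gcd-GCD i j)
... | Bézout.+- x y eq = period-+⁻ (gcd i j) (y * j) xs
  (subst (Period xs) (sym eq) (period-* x xs pi)) (period-* y xs pj)
... | Bézout.-+ x y eq = period-+⁻ (gcd i j) (x * i) xs
  (subst (Period xs) (sym eq) (period-* y xs pj)) (period-* x xs pi)

period-rot^ : ∀ {i} j (xs : List A) → Period xs i → Period (rot^ j xs) i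
period-rot^ {i = i} j xs p = ≡.trans (rot^-comm i j xs) (cong (rot^ j) p)

^ʷ-comm : ∀ (xs : List A) r → xs ^ʷ r ++ xs ≡ xs ++ xs ^ʷ r
^ʷ-comm xs zero    = sym (++-identityʳ xs)
^ʷ-comm xs (suc r) = ≡.trans (++-assoc xs (xs ^ʷ r) xs) (cong (xs ++_) (^ʷ-comm xs r))

power⇒period : ∀ (xs : List A) r → Period (xs ^ʷ r) (length xs)
power⇒period xs zero    = rot^-[] (length xs)
  where
  rot^-[] : ∀ i → rot^ {A} i [] ≡ []
  rot^-[] zero    = refl
  rot^-[] (suc i) = rot^-[] i
power⇒period xs (suc r) = ≡.trans (rot^-++ xs (xs ^ʷ r)) (^ʷ-comm xs r)

sum-map-^ʷ : ∀ (f : A → ℕ) xs r → sum (map f (xs ^ʷ r)) ≡ r * sum (map f xs)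
sum-map-^ʷ f xs zero    = refl
sum-map-^ʷ f xs (suc r) = begin
  sum (map f (xs ++ xs ^ʷ r))               ≡⟨ cong sum (map-++ f xs _) ⟩
  sum (map f xs ++ map f (xs ^ʷ r))         ≡⟨ sum-++ (map f xs) _ ⟩
  sum (map f xs) + sum (map f (xs ^ʷ r))    ≡⟨ cong (_+_ (sum (map f xs))) (sum-map-^ʷ f xs r) ⟩
  sum (map f xs) + r * sum (map f xs)       ∎
  where open ≡-Reasoning

length-^ʷ : ∀ (xs : List A) r → length (xs ^ʷ r) ≡ r * length xs
length-^ʷ xs zero    = refl
length-^ʷ xs (suc r) = ≡.trans (length-++ xs) (cong (_+_ (length xs)) (length-^ʷ xs r))

map-^ʷ : ∀ (f : A → B) xs r → map f (xs ^ʷ r) ≡ map f xs ^ʷ r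
map-^ʷ f xs zero    = refl
map-^ʷ f xs (suc r) = ≡.trans (map-++ f xs _) (cong (map f xs ++_) (map-^ʷ f xs r))

++-injective : ∀ (xs ys : List A) {us vs} → length xs ≡ length ys → xs ++ us ≡ ys ++ vs → xs ≡ ys × us ≡ vs
++-injective []       []       _   eq = refl , eq
++-injective (x ∷ xs) (y ∷ ys) len eq with ++-injective xs ys (suc-injective len) (∷-injectiveʳ eq)
... | xs≡ys , us≡vs = cong₂ _∷_ (∷-injectiveˡ eq) xs≡ys , us≡vs

-- Comparing initial segments in `comm` shows that `ys` starts with `xs`. What follows this copy
-- still commutes with `xs`, and induction applies.
commutes⇒power : ∀ m (xs ys : List A) → ys ++ xs ≡ xs ++ ys → length ys ≡ m * length xs → ys ≡ xs ^ʷ m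
commutes⇒power zero    xs []  comm len = refl
commutes⇒power (suc m) xs ys  comm len = begin
  ys                  ≡⟨ split ⟨
  us ++ vs            ≡⟨ cong (_++ vs) us≡xs ⟩
  xs ++ vs            ≡⟨ cong (xs ++_) (commutes⇒power m xs vs comm′ len′) ⟩
  xs ++ xs ^ʷ m       ∎
  where
  open ≡-Reasoning
  us = take (length xs) ys
  vs = drop (length xs) ys
  split : us ++ vs ≡ ys
  split = take++drop≡id (length xs) ys
  length-us : length us ≡ length xs
  length-us = ≡.trans (length-take (length xs) ys)
    (m≤n⇒m⊓n≡m (subst (length xs ≤_) (sym len) (m≤m+n (length xs) (m * length xs))))
  us≡xs : us ≡ xs
  us≡xs = proj₁ (++-injective us xs length-us (begin
    us ++ (vs ++ xs) ≡⟨ ++-assoc us vs xs ⟨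
    (us ++ vs) ++ xs ≡⟨ cong (_++ xs) split ⟩
    ys ++ xs         ≡⟨ comm ⟩
    xs ++ ys         ∎))
  ys≡xs++vs : ys ≡ xs ++ vs
  ys≡xs++vs = ≡.trans (sym split) (cong (_++ vs) us≡xs)
  comm′ : vs ++ xs ≡ xs ++ vs
  comm′ = ++-cancelˡ xs _ _ (begin
    xs ++ (vs ++ xs) ≡⟨ ++-assoc xs vs xs ⟨
    (xs ++ vs) ++ xs ≡⟨ cong (_++ xs) ys≡xs++vs ⟨
    ys ++ xs         ≡⟨ comm ⟩
    xs ++ ys         ≡⟨ cong (xs ++_) ys≡xs++vs ⟩
    xs ++ (xs ++ vs) ∎)
  len′ : length vs ≡ m * length xs
  len′ = +-cancelˡ-≡ (length xs) _ _ (≡.trans (sym (length-++ xs)) (≡.trans (cong length (sym ys≡xs++vs)) len))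

-- Cut `xs` after `p` letters. Rotation by `p` exchanges the two pieces, so having period `p` means
-- that they commute.
period⇒power : ∀ m p (xs : List A) → suc m * p ≡ length xs → Period xs p →
  xs ≡ take p xs ^ʷ suc m × length (take p xs) ≡ p
period⇒power m p xs len per = ≡.trans (sym split) (cong (us ++_) (commutes⇒power m us vs comm length-vs)) , length-us
  where
  open ≡-Reasoning
  us = take p xs
  vs = drop p xs
  split : us ++ vs ≡ xs
  split = take++drop≡id p xs
  length-us : length us ≡ p
  length-us = ≡.trans (length-take p xs) (m≤n⇒m⊓n≡m (subst (p ≤_) len (m≤m+n p (m * p))))
  comm : vs ++ us ≡ us ++ vs
  comm = begin
    vs ++ us                    ≡⟨ rot^-++ us vs ⟨
    rot^ (length us) (us ++ vs) ≡⟨ cong₂ rot^ length-us split ⟩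
    rot^ p xs                   ≡⟨ per ⟩
    xs                          ≡⟨ split ⟨
    us ++ vs                    ∎
  length-vs : length vs ≡ m * length us
  length-vs = +-cancelˡ-≡ (length us) _ _ (begin
    length us + length vs     ≡⟨ length-++ us ⟨
    length (us ++ vs)         ≡⟨ cong length split ⟩
    length xs                 ≡⟨ len ⟨
    p + m * p                 ≡⟨ cong (λ z → z + m * z) length-us ⟨
    length us + m * length us ∎)

-- The exponent of a word

-- The witness is the gcd of `m` and of all entries satisfying `P`. Starting the fold at `m` keeps
-- it a divisor of `m`.
gcd-closed⇒∃-divisor : {P : ℕ → Set} → (∀ i → Dec (P i)) → (∀ {i j} → P i → P j → P (gcd i j)) →
  (is : List ℕ) (m : ℕ) → P m → ∃[ p ] p ∣ m × P p × (∀ {i} → i ∈ is → P i → p ∣ i)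
gcd-closed⇒∃-divisor P? closed []       m Pm = m , ∣-refl , Pm , λ ()
gcd-closed⇒∃-divisor P? closed (i ∷ is) m Pm with gcd-closed⇒∃-divisor P? closed is m Pm | P? i
... | p , p∣m , Pp , least | no ¬Pi = p , p∣m , Pp , λ where
  (here refl) Pi → contradiction Pi ¬Pi
  (there j∈)  Pj → least j∈ Pj
... | p , p∣m , Pp , least | yes Pi = gcd i p , ∣-trans (gcd[m,n]∣n i p) p∣m , closed Pi Pp , λ where
  (here refl) _  → gcd[m,n]∣m i p
  (there j∈)  Pj → ∣-trans (gcd[m,n]∣n i p) (least j∈ Pj)

module Exponent {A : Set} (_≟ᴬ_ : DecidableEquality A) (xs : List A) where
  -- Abstract, because goals containing an exponent would otherwise normalise into the search.
  abstract
    private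
      minimal : ∃[ p ] p ∣ length xs × Period xs p × (∀ {i} → i ∈ upTo (suc (length xs)) → Period xs i → p ∣ i)
      minimal = gcd-closed⇒∃-divisor (λ i → ≡-dec _≟ᴬ_ (rot^ i xs) xs) (λ {i} {j} → period-gcd {i = i} {j} xs)
        (upTo (suc (length xs))) (length xs) (rot^-length xs)

  private
    p = proj₁ minimal

  -- The length divided by the minimal period `p`; for a nonempty list this is the largest `e` such
  -- that the list is an `e`-th power.
  exponent : ℕ
  exponent = quotient (proj₁ (proj₂ minimal))

  private
    length≡ : length xs ≡ exponent * p
    length≡ = _∣_.equality (proj₁ (proj₂ minimal))

  exponent∣length : exponent ∣ length xs
  exponent∣length = divides p (≡.trans length≡ (*-comm exponent p))

  module _ .{{_ : NonZero (length xs)}} where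
    private instance
      p≢0 : NonZero p
      p≢0 = ≢-nonZero λ p≡0 → ≢-nonZero⁻¹ (length xs)
        (≡.trans length≡ (≡.trans (cong (exponent *_) p≡0) (*-zeroʳ exponent)))

    -- By minimality `i = c * p`, and cancelling `p` in `exponent * p = d * c * p` gives the claim.
    -- The converse below reads the same equation backwards.
    period⇒∣exponent : ∀ {d i} → d * i ≡ length xs → Period xs i → d ∣ exponent
    period⇒∣exponent {d} {i} len per
      with proj₂ (proj₂ (proj₂ minimal)) (∈-upTo⁺ (s≤s (∣⇒≤ (divides d (sym len))))) per
    ... | divides c refl = divides c (*-cancelʳ-≡ _ _ p
      (≡.trans (sym length≡) (≡.trans (sym len) (≡.trans (sym (*-assoc d c p)) (cong (_* p) (*-comm d c))))))

    ∣exponent⇒period : ∀ {d i} .{{_ : NonZero d}} → d * i ≡ length xs → d ∣ exponent → Period xs i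
    ∣exponent⇒period {d} {i} len (divides c e≡c*d) = subst (Period xs) (*-cancelˡ-≡ _ _ d (begin
      d * (c * p)   ≡⟨ *-assoc d c p ⟨
      d * c * p     ≡⟨ cong (_* p) (≡.trans (*-comm d c) (sym e≡c*d)) ⟩
      exponent * p  ≡⟨ length≡ ⟨
      length xs     ≡⟨ len ⟨
      d * i         ∎)) (period-* c xs (proj₁ (proj₂ (proj₂ minimal))))
      where open ≡-Reasoning

-- Words with a prescribed number of b-steps

_≟ˢ_ : DecidableEquality Step
a-step ≟ˢ a-step = yes refl
a-step ≟ˢ b-step = no λ ()
b-step ≟ˢ a-step = no λ ()
b-step ≟ˢ b-step = yes refl

bIndicator : Step → ℕ
bIndicator a-step = 0
bIndicator b-step = 1

bWeight : List Step → ℕ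
bWeight w = sum (map bIndicator w)

-- The clauses follow Pascal's rule, which makes the count in `length-words` an induction.
words : ℕ → ℕ → List (List Step)
words zero    zero    = [] ∷ []
words zero    (suc k) = []
words (suc l) zero    = map (a-step ∷_) (words l zero)
words (suc l) (suc k) = map (a-step ∷_) (words l (suc k)) ++ map (b-step ∷_) (words l k)

∈-words⁺ : ∀ w → w ∈ words (length w) (bWeight w)
∈-words⁺ []           = here refl
∈-words⁺ (a-step ∷ w) with bWeight w | ∈-words⁺ w
... | zero  | w∈ = ∈-map⁺ (a-step ∷_) w∈
... | suc _ | w∈ = ∈-++⁺ˡ (∈-map⁺ (a-step ∷_) w∈)
∈-words⁺ (b-step ∷ w) = ∈-++⁺ʳ _ (∈-map⁺ (b-step ∷_) (∈-words⁺ w))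

∈-words⁻ : ∀ l k {w} → w ∈ words l k → length w ≡ l × bWeight w ≡ k
∈-words⁻ zero    zero    (here refl) = refl , refl
∈-words⁻ (suc l) zero    w∈ with ∈-map⁻ (a-step ∷_) w∈
... | v , v∈ , refl with ∈-words⁻ l zero v∈
...   | len , bs = cong suc len , bs
∈-words⁻ (suc l) (suc k) w∈ with ∈-++⁻ (map (a-step ∷_) (words l (suc k))) w∈
... | inj₁ w∈′ with ∈-map⁻ (a-step ∷_) w∈′
...   | v , v∈ , refl with ∈-words⁻ l (suc k) v∈
...     | len , bs = cong suc len , bs
∈-words⁻ (suc l) (suc k) w∈ | inj₂ w∈′ with ∈-map⁻ (b-step ∷_) w∈′
...   | v , v∈ , refl with ∈-words⁻ l k v∈
...     | len , bs = cong suc len , cong suc bs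

words-unique : ∀ l k → Unique (words l k)
words-unique zero    zero    = [] ∷ []
words-unique zero    (suc k) = []
words-unique (suc l) zero    = Unique.map⁺ ∷-injectiveʳ (words-unique l zero)
words-unique (suc l) (suc k) = Unique.++⁺
  (Unique.map⁺ ∷-injectiveʳ (words-unique l (suc k))) (Unique.map⁺ ∷-injectiveʳ (words-unique l k))
  λ (w∈ , w∈′) → case (∈-map⁻ (a-step ∷_) w∈ , ∈-map⁻ (b-step ∷_) w∈′) of λ where
    ((_ , _ , refl) , (_ , _ , ()))

length-words : ∀ l k → length (words l k) ≡ l C k
length-words zero    zero    = refl
length-words zero    (suc k) = refl
length-words (suc l) zero    = ≡.trans (length-map _ (words l zero)) (length-words l zero)
length-words (suc l) (suc k) = begin
  length (map (a-step ∷_) (words l (suc k)) ++ map (b-step ∷_) (words l k))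
    ≡⟨ length-++ (map (a-step ∷_) (words l (suc k))) ⟩
  length (map (a-step ∷_) (words l (suc k))) + length (map (b-step ∷_) (words l k))
    ≡⟨ cong₂ _+_ (length-map _ (words l (suc k))) (length-map _ (words l k)) ⟩
  length (words l (suc k)) + length (words l k)   ≡⟨ cong₂ _+_ (length-words l (suc k)) (length-words l k) ⟩
  l C suc k + l C k                               ≡⟨ +-comm (l C suc k) (l C k) ⟩
  l C k + l C suc k                               ≡⟨ nCk+nC[k+1]≡[n+1]C[k+1] l k ⟩
  suc l C suc k                                   ∎
  where open ≡-Reasoning

-- Exponents and powers of words in the two steps

open Exponent _≟ˢ_

^ʷ-injective : ∀ d .{{_ : NonZero d}} {xs ys : List A} → xs ^ʷ d ≡ ys ^ʷ d → xs ≡ ys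
^ʷ-injective d@(suc _) {xs} {ys} eq = proj₁ (++-injective xs ys (*-cancelˡ-≡ _ _ d
  (≡.trans (sym (length-^ʷ xs d)) (≡.trans (cong length eq) (length-^ʷ ys d)))) eq)

∣exponent⇒power : ∀ {d i} .{{_ : NonZero d}} w .{{_ : NonZero (length w)}} → d * i ≡ length w → d ∣ exponent w →
  ∃[ x ] w ≡ x ^ʷ d × length x ≡ i
∣exponent⇒power {suc d} {i} w len d∣e with period⇒power d i w len (∣exponent⇒period w len d∣e)
... | w≡ , len-x = take i w , w≡ , len-x

power⇒∣exponent : ∀ d x .{{_ : NonZero (length (x ^ʷ d))}} → d ∣ exponent (x ^ʷ d)
power⇒∣exponent d x = period⇒∣exponent (x ^ʷ d) (sym (length-^ʷ x d)) (power⇒period x d)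

exponent≢0 : ∀ w .{{_ : NonZero (length w)}} → NonZero (exponent w)
exponent≢0 w = ≢-nonZero λ e≡0 → ≢-nonZero⁻¹ (length w) (0∣⇒≡0 (subst (_∣ length w) e≡0 (exponent∣length w)))

-- The word is the `exponent w`-th power of its root, whose b-steps are repeated that often. With
-- `exponent∣length` this places the exponent among the divisors of `gcd l k`.
exponent∣bWeight : ∀ w .{{_ : NonZero (length w)}} → exponent w ∣ bWeight w
exponent∣bWeight w with ∣exponent⇒power {{exponent≢0 w}} w (sym (m∣n⇒n≡m*quotient (exponent∣length w))) ∣-refl
... | x , w≡x^e , _ = divides (bWeight x) (≡.trans (cong bWeight w≡x^e)
  (≡.trans (sum-map-^ʷ bIndicator x (exponent w)) (*-comm (exponent w) (bWeight x))))

module _ (l k d : ℕ) .{{dl≢0 : NonZero (d * l)}} where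
  private instance
    d≢0 : NonZero d
    d≢0 = m*n≢0⇒m≢0 d {l}

  -- A word whose exponent is divisible by `d` has a unique `d`-th root, and length and b-count of
  -- the root are those of the word divided by `d`.
  powers : filter (λ w → d ∣? exponent w) (words (d * l) (d * k)) ↭ map (_^ʷ d) (words l k)
  powers = unique-↭ (Unique.filter⁺ _ (words-unique (d * l) (d * k)))
    (Unique.map⁺ (^ʷ-injective d) (words-unique l k)) to from
    where
    to : ∀ {w} → w ∈ filter (λ w → d ∣? exponent w) (words (d * l) (d * k)) → w ∈ map (_^ʷ d) (words l k)
    to {w} w∈ with ∈-filter⁻ (λ w → d ∣? exponent w) {xs = words (d * l) (d * k)} w∈
    ... | w∈words , d∣e with ∈-words⁻ (d * l) (d * k) w∈words
    ... | len , bs with ∣exponent⇒power w {{subst NonZero (sym len) dl≢0}} (sym len) d∣e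
    ... | x , refl , refl = ∈-map⁺ (_^ʷ d) (subst (λ j → x ∈ words (length x) j)
      (*-cancelˡ-≡ _ _ d (≡.trans (sym (sum-map-^ʷ bIndicator x d)) bs)) (∈-words⁺ x))

    from : ∀ {w} → w ∈ map (_^ʷ d) (words l k) → w ∈ filter (λ w → d ∣? exponent w) (words (d * l) (d * k))
    from w∈ with ∈-map⁻ (_^ʷ d) w∈
    ... | x , x∈ , refl with ∈-words⁻ l k x∈
    ... | refl , refl = ∈-filter⁺ (λ w → d ∣? exponent w)
      (subst (x ^ʷ d ∈_) (cong₂ words (length-^ʷ x d) (sum-map-^ʷ bIndicator x d)) (∈-words⁺ (x ^ʷ d)))
      (power⇒∣exponent d x {{subst NonZero (sym (length-^ʷ x d)) dl≢0}})

  count-powers : + (l C k) ≡ sumOver (words (d * l) (d * k)) (λ w → ⟦ d ∣? exponent w ⟧)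
  count-powers = begin
    + (l C k)                                      ≡⟨ cong +_ (length-words l k) ⟨
    + length (words l k)                           ≡⟨ cong +_ (length-map (_^ʷ d) (words l k)) ⟨
    + length (map (_^ʷ d) (words l k))             ≡⟨ cong +_ (↭-length powers) ⟨
    + length (filter (λ w → d ∣? exponent w) (words (d * l) (d * k)))
      ≡⟨ length-filter (λ w → d ∣? exponent w) (words (d * l) (d * k)) ⟩
    sumOver (words (d * l) (d * k)) (λ w → ⟦ d ∣? exponent w ⟧) ∎
    where open ≡-Reasoning

-- Möbius inversion over exponents

sum-μ-∣ : ∀ {g t} .{{_ : NonZero g}} .{{_ : NonZero t}} → t ∣ g →
  sumOver (divisors g) (λ m → lift μ m ℤ.* ⟦ value m ∣? t ⟧) ≡ ⟦ t ≟ 1 ⟧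
sum-μ-∣ {g} {t} t∣g = begin
  sumOver (divisors g) (λ m → lift μ m ℤ.* ⟦ value m ∣? t ⟧)
    ≡⟨ sumOver-filter (λ m → value m ∣? t) (divisors g) (lift μ) ⟨
  sumOver (filter (λ m → value m ∣? t) (divisors g)) (lift μ) ≡⟨ sumOver-↭ (lift μ) common ⟩
  sumOver (divisors t) (lift μ)                               ≡⟨ sum-μ t ⟩
  ⟦ t ≟ 1 ⟧                                                   ∎
  where
  open ≡-Reasoning
  common : filter (λ m → value m ∣? t) (divisors g) ↭ divisors t
  common = unique-↭ (Unique.filter⁺ _ (divisors-unique g)) (divisors-unique t)
    (λ m∈ → ∈-divisors⁺ (proj₂ (∈-filter⁻ (λ m → value m ∣? t) {xs = divisors g} m∈)))
    (λ m∈ → ∈-filter⁺ (λ m → value m ∣? t) (∈-divisors⁺ (∣-trans (∈-divisors⁻ m∈) t∣g)) (∈-divisors⁻ m∈))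

-- If `q` does not divide `e`, all terms vanish. Otherwise `e = t * q`, and the sum reduces to the
-- divisors of `t`. The range of `m` is independent of `e`, so that the sum can be exchanged with
-- one over words.
sum-μ-* : ∀ {g e} q .{{_ : NonZero g}} .{{_ : NonZero e}} .{{_ : NonZero q}} → e ∣ q * g →
  sumOver (divisors g) (λ m → lift μ m ℤ.* ⟦ q * value m ∣? e ⟧) ≡ ⟦ e ≟ q ⟧
sum-μ-* {g} {e} q e∣qg with q ∣? e
... | no q∤e = ≡.trans (sumOver-cong (divisors g) λ {m} _ → ≡.trans
    (cong (lift μ m ℤ.*_) (⟦⟧-false (q * value m ∣? e) (q∤e ∘ ∣-trans (m∣m*n _)))) (ℤ.*-zeroʳ (lift μ m)))
  (≡.trans (sumOver-0 (divisors g)) (sym (⟦⟧-false (e ≟ q) λ e≡q → q∤e (∣-reflexive (sym e≡q)))))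
... | yes (divides t refl) = begin
  sumOver (divisors g) (λ m → lift μ m ℤ.* ⟦ q * value m ∣? t * q ⟧)
    ≡⟨ sumOver-cong (divisors g) (λ {m} _ → cong (ℤ._*_ (lift μ m)) (⟦⟧-cong
         (λ qm∣tq → *-cancelˡ-∣ q (subst (q * value m ∣_) (*-comm t q) qm∣tq))
         (λ m∣t → subst (q * value m ∣_) (*-comm q t) (*-monoʳ-∣ q m∣t))
         (q * value m ∣? t * q) (value m ∣? t))) ⟩
  sumOver (divisors g) (λ m → lift μ m ℤ.* ⟦ value m ∣? t ⟧)
    ≡⟨ sum-μ-∣ (*-cancelˡ-∣ q (subst (_∣ q * g) (*-comm t q) e∣qg)) ⟩
  ⟦ t ≟ 1 ⟧
    ≡⟨ ⟦⟧-cong (λ { refl → +-identityʳ q }) (λ tq≡q → *-cancelʳ-≡ t 1 q (≡.trans tq≡q (sym (+-identityʳ q)))) (t ≟ 1) (t * q ≟ q) ⟩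
  ⟦ t * q ≟ q ⟧ ∎
  where
  open ≡-Reasoning
  instance _ = m*n≢0⇒m≢0 t {q}

module _ (l k : ℕ) .{{l≢0 : NonZero l}} where
  private
    g = gcd l k
    instance
      g≢0 : NonZero g
      g≢0 = ≢-nonZero λ g≡0 → ≢-nonZero⁻¹ l (0∣⇒≡0 (subst (_∣ l) g≡0 (gcd[m,n]∣m l k)))

    exponent∣g : ∀ {w} → w ∈ words l k → NonZero (exponent w) × exponent w ∣ g
    exponent∣g {w} w∈ with ∈-words⁻ l k w∈
    ... | refl , refl = exponent≢0 w , gcd-greatest (exponent∣length w) (exponent∣bWeight w)

    count : ∀ d .{{_ : NonZero d}} → d ∣ g → + ((l ℕ./ d) C (k ℕ./ d)) ≡ sumOver (words l k) (λ w →
      ⟦ d ∣? exponent w ⟧)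
    count d d∣g = ≡.trans (count-powers (l ℕ./ d) (k ℕ./ d) d {{subst NonZero (sym l≡) l≢0}})
      (cong₂ (λ l k → sumOver (words l k) (λ w → ⟦ d ∣? exponent w ⟧)) l≡ k≡)
      where
      l≡ : d * (l ℕ./ d) ≡ l
      l≡ = m*[n/m]≡n (∣-trans d∣g (gcd[m,n]∣m l k))
      k≡ : d * (k ℕ./ d) ≡ k
      k≡ = m*[n/m]≡n (∣-trans d∣g (gcd[m,n]∣n l k))

    summand : (q m : ℕ) .{{_ : NonZero q}} .{{_ : NonZero m}} → ℤ
    summand q m = μ m ℤ.* + ((l ÷ q · m) C (k ÷ q · m))

  -- Each binomial is replaced by a sum of indicators over the words; after exchanging the sums,
  -- `sum-μ-*` evaluates the contribution of each word.
  count-exponent : ∀ q .{{_ : NonZero q}} → q ∣ g →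
    ∑ (divisors (g ℕ./ q)) (λ m → summand q m) ≡
    sumOver (words l k) (λ w → ⟦ exponent w ≟ q ⟧)
  count-exponent q q∣g = begin
    ∑ ds f
      ≡⟨ ∑≡sumOver ds f ⟩
    sumOver ds (lift f)
      ≡⟨ sumOver-cong ds term ⟩
    sumOver ds (λ m → sumOver ws (λ w → lift μ m ℤ.* ⟦ q * value m ∣? exponent w ⟧))
      ≡⟨ sumOver-swap ds ws _ ⟩
    sumOver ws (λ w → sumOver ds (λ m → lift μ m ℤ.* ⟦ q * value m ∣? exponent w ⟧))
      ≡⟨ sumOver-cong ws (λ {w} w∈ → let e≢0 , e∣g = exponent∣g w∈ in
           sum-μ-* q {{g/q≢0}} {{e≢0}} (subst (exponent w ∣_) (sym (m*[n/m]≡n q∣g)) e∣g)) ⟩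
    sumOver ws (λ w → ⟦ exponent w ≟ q ⟧) ∎
    where
    open ≡-Reasoning
    ds = divisors (g ℕ./ q)
    f : (m : ℕ) .{{_ : NonZero m}} → ℤ
    f m = summand q m
    ws = words l k
    term : ∀ {m} → m ∈ ds → lift f m ≡
      sumOver ws (λ w → lift μ m ℤ.* ⟦ q * value m ∣? exponent w ⟧)
    term {pos m} m∈ = ≡.trans
      (cong (ℤ._*_ (μ m)) (count (q * m) {{m*n≢0 q m}} (subst (q * m ∣_) (m*[n/m]≡n q∣g) (*-monoʳ-∣ q (∈-divisors⁻ m∈)))))
      (sym (sumOver-*ˡ ws (μ m) (λ w → ⟦ q * m ∣? exponent w ⟧)))
    g/q≢0 : NonZero (g ℕ./ q)
    g/q≢0 = m*n≢0⇒n≢0 q {{subst NonZero (sym (m*[n/m]≡n q∣g)) g≢0}}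

  -- A word contributes only at `q = exponent w`. Since the exponent divides `g`, this `q` belongs
  -- to `Q` exactly when it is coprime to `ω`.
  orbitSum≡count : ∀ ω → orbitSum l k ω ≡ sumOver (words l k) (λ w → ⟦ coprime? (exponent w) ℤ.∣ ω ∣ ⟧)
  orbitSum≡count ω = begin
    orbitSum l k ω
      ≡⟨ ∑≡sumOver Q f ⟩
    sumOver Q (lift f)
      ≡⟨ sumOver-cong Q (λ { {pos q} q∈ → count-exponent q (∈-divisors⁻ (proj₁ (∈-Q⁻ q∈))) }) ⟩
    sumOver Q (λ q → sumOver ws (λ w → ⟦ exponent w ≟ value q ⟧))
      ≡⟨ sumOver-swap Q ws _ ⟩
    sumOver ws (λ w → sumOver Q (λ q → ⟦ exponent w ≟ value q ⟧))
      ≡⟨ sumOver-cong ws inQ ⟩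
    sumOver ws (λ w → ⟦ coprime? (exponent w) ℤ.∣ ω ∣ ⟧) ∎
    where
    open ≡-Reasoning
    Q = coprimeDivisors g ω
    ws = words l k
    f : (q : ℕ) .{{_ : NonZero q}} → ℤ
    f q = ∑ (divisors (g ℕ./ q)) (λ m → summand q m)
    coprimeω? : Decidable (λ q → Coprime (value q) ℤ.∣ ω ∣)
    coprimeω? q = coprime? (value q) ℤ.∣ ω ∣
    ∈-Q⁻ : ∀ {q} → q ∈ Q → q ∈ divisors g × Coprime (value q) ℤ.∣ ω ∣
    ∈-Q⁻ = ∈-filter⁻ coprimeω? {xs = divisors g}
    -- Positive numbers compared by value, so that the indicators in the sum are those of
    -- `sumOver-∈` and `sumOver-∉`.
    S : DecSetoid 0ℓ 0ℓ
    S = record { isDecEquivalence = record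
      { isEquivalence = On.isEquivalence value ≡.isEquivalence ; _≟_ = λ c d → value c ≟ value d } }
    inQ : ∀ {w} → w ∈ ws → sumOver Q (λ q → ⟦ exponent w ≟ value q ⟧) ≡ ⟦ coprime? (exponent w) ℤ.∣ ω ∣ ⟧
    inQ {w} w∈ = decide (coprime? (exponent w) ℤ.∣ ω ∣)
      where
      e∣g = proj₂ (exponent∣g w∈)
      e⁺ = pos (exponent w) {{proj₁ (exponent∣g w∈)}}
      decide : (c? : Dec (Coprime (exponent w) ℤ.∣ ω ∣)) → sumOver Q (λ q → ⟦ exponent w ≟ value q ⟧) ≡ ⟦ c? ⟧
      decide (yes cop) = sumOver-∈ S e⁺
        (AllPairs.map (λ c≢d → c≢d ∘ value-injective) (Unique.filter⁺ coprimeω? (divisors-unique g)))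
        (Any.map (cong value) (∈-filter⁺ coprimeω? (∈-divisors⁺ {d = e⁺} e∣g) cop))
      decide (no ¬cop) = sumOver-∉ S e⁺ Q λ e∈Q → case find e∈Q of λ where
        (q , q∈Q , e≡q) → ¬cop (subst (λ e → Coprime e ℤ.∣ ω ∣) (sym e≡q) (proj₂ (∈-Q⁻ q∈Q)))

-- Cardinalities of quotients

map-unique : {f : A → B} {xs : List A} →
  (∀ {x y} → x ∈ xs → y ∈ xs → f x ≡ f y → x ≡ y) → Unique xs → Unique (map f xs)
map-unique inj []           = []
map-unique inj (x∉xs ∷ xs!) =
  Allₚ.map⁺ (All.tabulate λ y∈xs fx≡fy → All.lookup x∉xs y∈xs (inj (here refl) (there y∈xs) fx≡fy)) ∷
  map-unique (λ x∈ y∈ → inj (there x∈) (there y∈)) xs!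

length-cartesianProduct : (xs : List A) (ys : List B) → length (cartesianProduct xs ys) ≡ length xs * length ys
length-cartesianProduct []       ys = refl
length-cartesianProduct (x ∷ xs) ys = ≡.trans (length-++ (map (x ,_) ys))
  (cong₂ _+_ (length-map (x ,_) ys) (length-cartesianProduct xs ys))

module _ (S : DecSetoid 0ℓ 0ℓ) where
  open DecSetoid S using (Carrier; setoid; _≈_) renaming (_≟_ to _≈?_; trans to ≈-trans; sym to ≈-sym)
  open SetoidMembership setoid using () renaming (_∈_ to _∈ˢ_)
  open SetoidUnique setoid using () renaming (Unique to Uniqueˢ)

  index-unique : ∀ {x ys} → Uniqueˢ ys → (x∈ys : x ∈ˢ ys) → ∀ i → x ≈ lookup ys i → Any.index x∈ys ≡ i
  index-unique (_    ∷ _)   (here _)     zero    _   = refl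
  index-unique (y∉ys ∷ _)   (here x≈y)   (suc i) x≈z =
    contradiction (≈-trans (≈-sym x≈y) x≈z) (All.lookup y∉ys (∈-lookup i))
  index-unique (y∉ys ∷ _)   (there x∈ys) zero    x≈y =
    contradiction x∈ys (All¬⇒¬Any (All.map (λ ¬y≈z x≈z → ¬y≈z (≈-trans (≈-sym x≈y) x≈z)) y∉ys))
  index-unique (_    ∷ ys!) (there x∈ys) (suc i) x≈z = cong suc (index-unique ys! x∈ys i x≈z)

  -- Each class is sent to the position of its representative in `ys`. By `index-unique` this
  -- position depends only on the class.
  representatives⇒cardinality : {C : Set} (f : C → Carrier) {ys : List Carrier} → Uniqueˢ ys →
    (∀ c → f c ∈ˢ ys) → (∀ {y} → y ∈ ys → ∃[ c ] f c ≡ y) → HasCardinality (On.setoid setoid f) (length ys)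
  representatives⇒cardinality f {ys} ys! covers inv = record
    { to        = λ c → Any.index (covers c)
    ; from      = λ i → proj₁ (inv (∈-lookup i))
    ; to-cong   = λ {c} {d} c≈d → index-unique ys! (covers c) _ (≈-trans c≈d (Anyₚ.lookup-index (covers d)))
    ; from-cong = λ { refl → DecSetoid.refl S }
    ; inverse   = (λ {i} {c} c≈i → index-unique ys! (covers c) i
                    (≈-trans c≈i (DecSetoid.reflexive S (proj₂ (inv (∈-lookup i))))))
                , (λ { {c} refl → ≈-trans (DecSetoid.reflexive S (proj₂ (inv (∈-lookup _))))
                    (≈-sym (Anyₚ.lookup-index (covers c))) })
    }

  -- Double counting of the pairs of a representative `y` and an equivalent `x` in `xs`: there are
  -- `l` for each `y`, and one for each `x`.
  length-deduplicate : (xs : List Carrier) (l : ℕ) →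
    (∀ {x} → x ∈ xs → length (filter (x ≈?_) xs) ≡ l) → + length (deduplicate _≈?_ xs) ℤ.* + l ≡ + length xs
  length-deduplicate xs l class-size = begin
    + length ys ℤ.* + l                          ≡⟨ sumOver-const ys (+ l) ⟨
    sumOver ys (λ _ → + l)
      ≡⟨ sumOver-cong ys (λ {y} y∈ys → sym (≡.trans (sym (length-filter (y ≈?_) xs))
                                                      (cong +_ (class-size (∈-deduplicate⁻ _≈?_ xs y∈ys))))) ⟩
    sumOver ys (λ y → sumOver xs (λ x → ⟦ y ≈? x ⟧)) ≡⟨ sumOver-swap ys xs _ ⟩
    sumOver xs (λ x → sumOver ys (λ y → ⟦ y ≈? x ⟧))
      ≡⟨ sumOver-cong xs (λ {x} x∈xs → ≡.trans
           (sumOver-cong ys (λ {y} _ → ⟦⟧-cong ≈-sym ≈-sym (y ≈? x) (x ≈? y)))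
           (sumOver-∈ S x (deduplicate-! S xs)
             (SetoidMembershipₚ.∈-deduplicate⁺ setoid _≈?_ (λ z≈y x≈y → ≈-trans x≈y (≈-sym z≈y))
               (Any.map (DecSetoid.reflexive S) x∈xs)))) ⟩
    sumOver xs (λ _ → 1ℤ)                        ≡⟨ sumOver-const xs 1ℤ ⟩
    + length xs ℤ.* 1ℤ                           ≡⟨ ℤ.*-identityʳ (+ length xs) ⟩
    + length xs                                  ∎
    where
    open ≡-Reasoning
    ys = deduplicate _≈?_ xs

-- Circuits as closed walks

module _ (n a b : ℕ) .{{_ : NonZero n}} where
  open Circulant n a b hiding (Connected; 𝒫)

  displacement : List Step → ℕ
  displacement w = sum (map stepSize w)

  walk : Vertex → List Step → List Bond
  walk v []      = []
  walk v (s ∷ w) = bond v s ∷ walk (terminus (bond v s)) w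

  end : Vertex → List Step → Vertex
  end v []      = v
  end v (s ∷ w) = end (terminus (bond v s)) w

  toℕ-mod : ∀ m → toℕ (m mod n) ≡ m % n
  toℕ-mod m = Fin.toℕ-fromℕ< (m%n<n m n)

  toℕ-end : ∀ v w → toℕ (end v w) ≡ (toℕ v + displacement w) % n
  toℕ-end v []      = sym (≡.trans (cong (_% n) (+-identityʳ (toℕ v))) (m<n⇒m%n≡m (Fin.toℕ<n v)))
  toℕ-end v (s ∷ w) = begin
    toℕ (end (terminus (bond v s)) w)                      ≡⟨ toℕ-end (terminus (bond v s)) w ⟩
    (toℕ ((toℕ v + stepSize s) mod n) + displacement w) % n ≡⟨ cong (λ t → (t + displacement w) % n) (toℕ-mod _) ⟩
    ((toℕ v + stepSize s) % n + displacement w) % n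
      ≡⟨ %-distribˡ-+ ((toℕ v + stepSize s) % n) (displacement w) n ⟩
    ((toℕ v + stepSize s) % n % n + displacement w % n) % n
      ≡⟨ cong (λ t → (t + displacement w % n) % n) (m%n%n≡m%n (toℕ v + stepSize s) n) ⟩
    ((toℕ v + stepSize s) % n + displacement w % n) % n    ≡⟨ %-distribˡ-+ (toℕ v + stepSize s) (displacement w) n ⟨
    (toℕ v + stepSize s + displacement w) % n
      ≡⟨ cong (_% n) (+-assoc (toℕ v) (stepSize s) (displacement w)) ⟩
    (toℕ v + displacement (s ∷ w)) % n                     ∎
    where open ≡-Reasoning

  closed⁺ : ∀ v w → n ∣ displacement w → end v w ≡ v
  closed⁺ v w (divides c eq) = Fin.toℕ-injective (begin
    toℕ (end v w)                   ≡⟨ toℕ-end v w ⟩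
    (toℕ v + displacement w) % n    ≡⟨ cong (λ d → (toℕ v + d) % n) eq ⟩
    (toℕ v + c * n) % n             ≡⟨ [m+kn]%n≡m%n (toℕ v) c n ⟩
    toℕ v % n                       ≡⟨ m<n⇒m%n≡m (Fin.toℕ<n v) ⟩
    toℕ v                           ∎)
    where open ≡-Reasoning

  closed⁻ : ∀ v w → end v w ≡ v → n ∣ displacement w
  closed⁻ v w eq = divides (t ℕ./ n) (+-cancelˡ-≡ (toℕ v) _ _ (begin
    t                     ≡⟨ m≡m%n+[m/n]*n t n ⟩
    t % n + t ℕ./ n * n     ≡⟨ cong (_+ t ℕ./ n * n) (≡.trans (sym (toℕ-end v w)) (cong toℕ eq)) ⟩
    toℕ v + t ℕ./ n * n     ∎))
    where
    open ≡-Reasoning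
    t = toℕ v + displacement w

  map-step-walk : ∀ v w → map step (walk v w) ≡ w
  map-step-walk v []      = refl
  map-step-walk v (s ∷ w) = cong (s ∷_) (map-step-walk _ w)

  length-walk : ∀ v w → length (walk v w) ≡ length w
  length-walk v w = ≡.trans (sym (length-map step (walk v w))) (cong length (map-step-walk v w))

  walk-++ : ∀ v w w′ → walk v (w ++ w′) ≡ walk v w ++ walk (end v w) w′
  walk-++ v []      w′ = refl
  walk-++ v (s ∷ w) w′ = cong (bond v s ∷_) (walk-++ _ w w′)

  end-++ : ∀ v w w′ → end v (w ++ w′) ≡ end (end v w) w′
  end-++ v []      w′ = refl
  end-++ v (s ∷ w) w′ = end-++ _ w w′

  -- The first bond reveals the start, which an empty walk would lose; the steps reveal the word.
  walk-injective : ∀ {v v′ w w′} .{{_ : NonZero (length w)}} → walk v w ≡ walk v′ w′ → (v , w) ≡ (v′ , w′)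
  walk-injective {v} {v′} {s ∷ w} {s′ ∷ w′} eq = cong₂ _,_ (cong origin (∷-injectiveˡ eq))
    (≡.trans (sym (map-step-walk v (s ∷ w))) (≡.trans (cong (map step) eq) (map-step-walk v′ (s′ ∷ w′))))

  walk-^ʷ : ∀ v w r → end v w ≡ v → walk v (w ^ʷ r) ≡ walk v w ^^ r
  walk-^ʷ v w zero    closed = refl
  walk-^ʷ v w (suc r) closed = ≡.trans (walk-++ v w (w ^ʷ r))
    (cong (walk v w ++_) (≡.trans (cong (λ u → walk u (w ^ʷ r)) closed) (walk-^ʷ v w r closed)))

  bCount-bWeight : ∀ c → bCount c ≡ bWeight (map step c)
  bCount-bWeight []                  = refl
  bCount-bWeight (bond _ a-step ∷ c) = bCount-bWeight c
  bCount-bWeight (bond _ b-step ∷ c) = cong suc (bCount-bWeight c)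

  walk-isPath : ∀ v w → IsPath (walk v w)
  walk-isPath v []           = []
  walk-isPath v (s ∷ [])     = [-]
  walk-isPath v (s ∷ t ∷ w)  = refl ∷ walk-isPath _ (t ∷ w)

  isPath⇒walk : ∀ e es → IsPath (e ∷ es) → e ∷ es ≡ walk (origin e) (map step (e ∷ es))
  isPath⇒walk e []       _          = refl
  isPath⇒walk e (f ∷ es) (e⟶f ∷ p) = cong (e ∷_)
    (≡.trans (isPath⇒walk f es p) (cong (λ v → walk v (map step (f ∷ es))) (sym e⟶f)))

  terminus-last-walk : ∀ v s w → Maybe.map terminus (last (walk v (s ∷ w))) ≡ just (end v (s ∷ w))
  terminus-last-walk v s []      = refl
  terminus-last-walk v s (t ∷ w) = terminus-last-walk _ t w

  walk-isCircuit : ∀ v w → n ∣ displacement w → IsCircuit (walk v w)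
  walk-isCircuit v []      _ = [] , refl
  walk-isCircuit v (s ∷ w) d = walk-isPath v (s ∷ w) , ≡.trans (terminus-last-walk v s w) (cong just (closed⁺ v (s ∷ w) d))

  isCircuit⇒walk : ∀ c .{{_ : NonZero (length c)}} → IsCircuit c → ∃[ v ] c ≡ walk v (map step c)
  isCircuit⇒walk (e ∷ es) (path , _) = origin e , isPath⇒walk e es path

  isCircuit⇒n∣displacement : ∀ c → IsCircuit c → n ∣ displacement (map step c)
  isCircuit⇒n∣displacement []       _ = n ∣0
  isCircuit⇒n∣displacement (e ∷ es) (path , ends) = closed⁻ (origin e) (map step (e ∷ es)) (just-injective (begin
    just (end (origin e) (map step (e ∷ es)))
      ≡⟨ terminus-last-walk (origin e) (step e) (map step es) ⟨
    Maybe.map terminus (last (walk (origin e) (map step (e ∷ es))))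
      ≡⟨ cong (Maybe.map terminus ∘ last) (isPath⇒walk e es path) ⟨
    Maybe.map terminus (last (e ∷ es))                                   ≡⟨ ends ⟩
    just (origin e)                                                      ∎))
    where open ≡-Reasoning

  -- As the whole walk is closed, the part along `w′` ends at `v`, where the part along `w` begins.
  rot^-walk : ∀ v w w′ → n ∣ displacement (w ++ w′) → rot^ (length w) (walk v (w ++ w′)) ≡ walk (end v w) (w′ ++ w)
  rot^-walk v w w′ d = begin
    rot^ (length w) (walk v (w ++ w′))
      ≡⟨ cong₂ rot^ (sym (length-walk v w)) (walk-++ v w w′) ⟩
    rot^ (length (walk v w)) (walk v w ++ walk (end v w) w′)    ≡⟨ rot^-++ (walk v w) _ ⟩
    walk (end v w) w′ ++ walk v w
      ≡⟨ cong (λ u → walk (end v w) w′ ++ walk u w) (≡.trans (sym (end-++ v w w′)) (closed⁺ v (w ++ w′) d)) ⟨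
    walk (end v w) w′ ++ walk (end (end v w) w′) w              ≡⟨ walk-++ (end v w) w′ w ⟨
    walk (end v w) (w′ ++ w)                                    ∎
    where open ≡-Reasoning

  -- Rotation equivalence

  _≟ᵇ_ : DecidableEquality Bond
  bond u s ≟ᵇ bond v t with u Fin.≟ v | s ≟ˢ t
  ... | yes refl | yes refl = yes refl
  ... | no u≢v   | _        = no λ { refl → u≢v refl }
  ... | yes _    | no s≢t   = no λ { refl → s≢t refl }

  rotate≡rot : ∀ c → rotate c ≡ rot c
  rotate≡rot []      = refl
  rotate≡rot (e ∷ c) = refl

  rot-inverse : (xs : List A) → ∃[ i ] rot^ i (rot xs) ≡ xs
  rot-inverse []       = 0 , refl
  rot-inverse (x ∷ xs) = length xs , rot^-++ xs (x ∷ [])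

  -- Rotation has finite order on each list, so backward steps of the closure are forward rotations
  -- too.
  ∼⇒rot^ : ∀ {c d} → c ∼ d → ∃[ i ] rot^ i c ≡ d
  ∼⇒rot^ ε = 0 , refl
  ∼⇒rot^ {c} (fwd refl ◅ c′∼d) with ∼⇒rot^ c′∼d
  ... | i , eq = suc i , ≡.trans (cong (rot^ i) (sym (rotate≡rot c))) eq
  ∼⇒rot^ (_◅_ {j = c′} (bwd refl) c′∼d) with ∼⇒rot^ c′∼d | rot-inverse c′
  ... | i , eq | j , inv = j + i , (begin
    rot^ (j + i) (rotate c′)      ≡⟨ rot^-+ j i (rotate c′) ⟩
    rot^ i (rot^ j (rotate c′))   ≡⟨ cong (rot^ i ∘ rot^ j) (rotate≡rot c′) ⟩
    rot^ i (rot^ j (rot c′))      ≡⟨ cong (rot^ i) inv ⟩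
    rot^ i c′                     ≡⟨ eq ⟩
    _                             ∎)
    where open ≡-Reasoning

  rot^⇒∼ : ∀ i c → c ∼ rot^ i c
  rot^⇒∼ zero    c = ε
  rot^⇒∼ (suc i) c = fwd (rotate≡rot c) ◅ rot^⇒∼ i (rot c)

  -- The length is a period, so the amount of rotation can be reduced modulo it. This bound makes
  -- `∼` decidable by search.
  ∼⇒rot^< : ∀ {c d} .{{_ : NonZero (length c)}} → c ∼ d → ∃[ i ] i < length c × rot^ i c ≡ d
  ∼⇒rot^< {c} {d} c∼d with ∼⇒rot^ c∼d
  ... | i , eq = i % length c , m%n<n i (length c) , (begin
    rot^ (i % length c) c
      ≡⟨ cong (rot^ (i % length c)) (period-* (i ℕ./ length c) c (rot^-length c)) ⟨
    rot^ (i % length c) (rot^ (i ℕ./ length c * length c) c)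
      ≡⟨ rot^-+ (i ℕ./ length c * length c) (i % length c) c ⟨
    rot^ (i ℕ./ length c * length c + i % length c) c
      ≡⟨ cong (λ m → rot^ m c) (≡.trans (+-comm (i ℕ./ length c * length c) _) (sym (m≡m%n+[m/n]*n i (length c)))) ⟩
    rot^ i c                                                  ≡⟨ eq ⟩
    d                                                         ∎)
    where open ≡-Reasoning

  rotationDecSetoid : DecSetoid 0ℓ 0ℓ
  rotationDecSetoid = record
    { isDecEquivalence = record { isEquivalence = Setoid.isEquivalence rotationSetoid ; _≟_ = _∼?_ } }
    where
    _∼?_ : Decidable₂ _∼_
    []        ∼? []      = yes ε
    []        ∼? (e ∷ d) = no λ c∼d → case ∼⇒rot^ c∼d of λ where
      (i , eq) → case ≡.trans (sym (length-rot^ i [])) (cong length eq) of λ ()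
    c@(_ ∷ _) ∼? d       = map′
      (λ any → case find any of λ where (i , _ , refl) → rot^⇒∼ i c)
      (λ c∼d → case ∼⇒rot^< c∼d of λ where (i , i< , eq) → lose (∈-upTo⁺ i<) eq)
      (Any.any? (λ i → ≡-dec _≟ᵇ_ (rot^ i c) d) (upTo (length c)))

  -- Primitive circuits

  sum-map-step-rot^ : ∀ (f : Step → ℕ) i c → sum (map f (map step (rot^ i c))) ≡ sum (map f (map step c))
  sum-map-step-rot^ f i c = sum-↭ (map⁺ f (map⁺ step (↭-sym (rot^-↭ i c))))

  rot^-isCircuit : ∀ i {c} → IsCircuit c → IsCircuit (rot^ i c)
  rot^-isCircuit zero            circuit = circuit
  rot^-isCircuit (suc i) {[]}     circuit = rot^-isCircuit i circuit
  rot^-isCircuit (suc i) {e ∷ es} circuit = rot^-isCircuit i (subst IsCircuit (sym (begin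
    rot (e ∷ es)                             ≡⟨ cong rot (isPath⇒walk e es (proj₁ circuit)) ⟩
    rot^ 1 (walk v (step e ∷ w))             ≡⟨ rot^-walk v (step e ∷ []) w n∣d ⟩
    walk u (w ∷ʳ step e)                     ∎))
    (walk-isCircuit u (w ∷ʳ step e) (subst (n ∣_) (sum-↭ (map⁺ stepSize (∷↭∷ʳ (step e) w))) n∣d)))
    where
    open ≡-Reasoning
    v = origin e
    w = map step es
    u = terminus e
    n∣d : n ∣ displacement (step e ∷ w)
    n∣d = isCircuit⇒n∣displacement (e ∷ es) circuit

  isPrimitive-∼ : ∀ {c d} → c ∼ d → IsPrimitive c → IsPrimitive d
  isPrimitive-∼ c∼d c-prim (c₀ , r , circuit , r>1 , d∼c₀^r) =
    c-prim (c₀ , r , circuit , r>1 , Setoid.trans rotationSetoid c∼d d∼c₀^r)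

  -- Such a `q` would give the period `p = gcd q (length c)`, a proper divisor of the length, so the
  -- word would be a proper power of its first `p` letters `x`. It then remains to see that `x`
  -- itself closes up.
  isPrimitive⇒aperiodic : ∀ {c q} → IsCircuit c → IsPrimitive c → 0 < q → q < length c → ¬ Period c q
  isPrimitive⇒aperiodic {c@(e ∷ es)} {q} circuit c-prim 0<q q<l per
    with gcd[m,n]∣n q (length c) | period-gcd {i = q} {j = length c} c per (rot^-length c)
  ... | divides zero    ()   | _
  ... | divides 1       l≡p  | _ = <⇒≱ q<l (subst (_≤ q) (sym (≡.trans l≡p (+-identityʳ _)))
    (∣⇒≤ {{>-nonZero 0<q}} (gcd[m,n]∣m q (length c))))
  ... | divides r@(2+ m) l≡rp | per-p
    with period⇒power (suc m) p w (≡.trans (sym l≡rp) (sym (length-map step c)))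
           (≡.trans (sym (rot^-map step p c)) (cong (map step) per-p))
    where
    p = gcd q (length c)
    w = map step c
  ... | w≡x^r , length-x = c-prim (walk v x , r , walk-isCircuit v x n∣dx , s≤s (s≤s z≤n) ,
    Setoid.reflexive rotationSetoid (≡.trans c≡walk (≡.trans (cong (walk v) w≡x^r) (walk-^ʷ v x r (closed⁺ v x n∣dx)))))
    where
    open ≡-Reasoning
    p = gcd q (length c)
    w = map step c
    x = take p w
    v = origin e
    y = x ^ʷ suc m
    c≡walk : c ≡ walk v w
    c≡walk = isPath⇒walk e es (proj₁ circuit)
    returns : walk v w ≡ walk (end v x) (y ++ x)
    returns = begin
      walk v w                          ≡⟨ c≡walk ⟨
      c                                 ≡⟨ per-p ⟨
      rot^ p c                          ≡⟨ cong₂ rot^ (sym length-x) (≡.trans c≡walk (cong (walk v) w≡x^r)) ⟩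
      rot^ (length x) (walk v (x ++ y))
        ≡⟨ rot^-walk v x y (subst (λ w → n ∣ displacement w) w≡x^r (isCircuit⇒n∣displacement c circuit)) ⟩
      walk (end v x) (y ++ x)           ∎
    n∣dx : n ∣ displacement x
    -- Rotation by `p` moves the start from `v` to `end v x` but leaves the circuit unchanged, so
    -- the two vertices agree.
    n∣dx = closed⁻ v x (sym (cong proj₁ (walk-injective returns)))

  -- A common divisor `d > 1` would give a root `x` with `w = x ^ʷ d` and displacement `(ω / d) n`.
  -- Then `x` closes up, and the walk is the `d`-th power of a circuit.
  isPrimitive⇒coprime : ∀ {ω} v w .{{_ : NonZero (length w)}} → displacement w ≡ ω * n →
    IsPrimitive (walk v w) → Coprime (exponent w) ω
  isPrimitive⇒coprime {ω} v w disp prim {d} (d∣e , divides t ω≡t*d) with d ≟ 1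
  ... | yes d≡1 = d≡1
  ... | no  d≢1 with quotient (∣-trans d∣e (exponent∣length w)) | m∣n⇒n≡m*quotient (∣-trans d∣e (exponent∣length w))
  ... | i | length≡ with ∣exponent⇒power {d = d} {i = i} {{d≢0}} w (sym length≡) d∣e
    where
    d≢0 : NonZero d
    d≢0 = ≢-nonZero λ { refl → ≢-nonZero⁻¹ (exponent w) {{exponent≢0 w}} (0∣⇒≡0 d∣e) }
  ... | x , refl , _ = contradiction
    (walk v x , d , walk-isCircuit v x n∣dx , nonTrivial⇒n>1 d {{d>1}} ,
      Setoid.reflexive rotationSetoid (walk-^ʷ v x d (closed⁺ v x n∣dx)))
    prim
    where
    d≢0 : NonZero d
    d≢0 = ≢-nonZero λ { refl → ≢-nonZero⁻¹ (exponent (x ^ʷ d)) {{exponent≢0 (x ^ʷ d)}} (0∣⇒≡0 d∣e) }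
    d>1 : NonTrivial d
    d>1 = n>1⇒nonTrivial (≤∧≢⇒< (>-nonZero⁻¹ d {{d≢0}}) (d≢1 ∘ sym))
    n∣dx : n ∣ displacement x
    n∣dx = divides t (*-cancelˡ-≡ _ _ d {{d≢0}} (begin
      d * displacement x        ≡⟨ sum-map-^ʷ stepSize x d ⟨
      displacement (x ^ʷ d)     ≡⟨ disp ⟩
      ω * n                     ≡⟨ cong (_* n) (≡.trans ω≡t*d (*-comm t d)) ⟩
      d * t * n                 ≡⟨ *-assoc d t n ⟩
      d * (t * n)               ∎))
      where open ≡-Reasoning

  -- If the walk is a rotation of `c₀ ^^ r`, then `r` divides the exponent. As `c₀` closes up, its
  -- displacement is `t * n`, so `ω = r * t` and `r` divides `ω` as well. Coprimality excludes
  -- `r > 1`.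
  coprime⇒isPrimitive : ∀ {ω} v w .{{_ : NonZero (length w)}} → displacement w ≡ ω * n →
    Coprime (exponent w) ω → IsPrimitive (walk v w)
  coprime⇒isPrimitive {ω} v w disp cop (c₀ , r , circuit , r>1 , w∼c₀^r)
    with ∼⇒rot^ (Setoid.sym rotationSetoid w∼c₀^r) | isCircuit⇒n∣displacement c₀ circuit
  ... | i , eq | divides t dx≡t*n = <-irrefl (sym (cop (r∣e , r∣ω))) r>1
    where
    open ≡-Reasoning
    x = map step c₀
    w≡ : w ≡ rot^ i (x ^ʷ r)
    w≡ = begin
      w                             ≡⟨ map-step-walk v w ⟨
      map step (walk v w)           ≡⟨ cong (map step) eq ⟨
      map step (rot^ i (c₀ ^^ r))   ≡⟨ rot^-map step i (c₀ ^^ r) ⟩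
      rot^ i (map step (c₀ ^^ r))   ≡⟨ cong (rot^ i) (map-^ʷ step c₀ r) ⟩
      rot^ i (x ^ʷ r)               ∎
    r∣e : r ∣ exponent w
    r∣e = period⇒∣exponent w
      (≡.trans (sym (length-^ʷ x r)) (≡.trans (sym (length-rot^ i (x ^ʷ r))) (cong length (sym w≡))))
      (subst (λ w → Period w (length x)) (sym w≡) (period-rot^ {i = length x} i (x ^ʷ r) (power⇒period x r)))
    r∣ω : r ∣ ω
    r∣ω = divides t (*-cancelʳ-≡ _ _ n (begin
      ω * n                               ≡⟨ disp ⟨
      displacement w                      ≡⟨ cong displacement w≡ ⟩
      displacement (rot^ i (x ^ʷ r))      ≡⟨ sum-↭ (map⁺ stepSize (rot^-↭ i (x ^ʷ r))) ⟨
      displacement (x ^ʷ r)               ≡⟨ sum-map-^ʷ stepSize x r ⟩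
      r * displacement x                  ≡⟨ cong (r *_) dx≡t*n ⟩
      r * (t * n)                         ≡⟨ *-assoc r t n ⟨
      r * t * n                           ≡⟨ cong (_* n) (*-comm r t) ⟩
      t * r * n                           ∎))

  displacement-words : ∀ l k {w} → w ∈ words l k → + displacement w ≡ + l ℤ.* + a ℤ.+ + k ℤ.* (+ b ℤ.- + a)
  displacement-words l k {w} w∈ with ∈-words⁻ l k w∈
  ... | refl , refl = lemma w
    where
    open ≡-Reasoning
    lemma : ∀ w → + displacement w ≡ + length w ℤ.* + a ℤ.+ + bWeight w ℤ.* (+ b ℤ.- + a)
    lemma []           = refl
    lemma (a-step ∷ w) = ≡.trans (cong (ℤ._+_ (+ a)) (lemma w)) (identity (+ length w) (+ bWeight w) (+ a) (+ b))
      where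
      identity : ∀ l k a b → a ℤ.+ (l ℤ.* a ℤ.+ k ℤ.* (b ℤ.- a)) ≡ (+ 1 ℤ.+ l) ℤ.* a ℤ.+ k ℤ.* (b ℤ.- a)
      identity = solve-∀
    lemma (b-step ∷ w) = ≡.trans (cong (ℤ._+_ (+ b)) (lemma w)) (identity (+ length w) (+ bWeight w) (+ a) (+ b))
      where
      identity : ∀ l k a b → b ℤ.+ (l ℤ.* a ℤ.+ k ℤ.* (b ℤ.- a)) ≡
        (+ 1 ℤ.+ l) ℤ.* a ℤ.+ (+ 1 ℤ.+ k) ℤ.* (b ℤ.- a)
      identity = solve-∀

  -- Counting the primitive circuits and their orbits

  module _ (l k ω : ℕ) .{{_ : NonZero l}} (disp : ∀ {w} → w ∈ words l k → displacement w ≡ ω * n) where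
    open PrimitiveCircuit
    open DecSetoid rotationDecSetoid using () renaming (_≟_ to _∼?_)

    private
      coprimeω? : Decidable (λ w → Coprime (exponent w) ω)
      coprimeω? w = coprime? (exponent w) ω

      length≢0 : ∀ {w : List A} → length w ≡ l → NonZero (length w)
      length≢0 eq = subst NonZero (sym eq) (≢-nonZero (≢-nonZero⁻¹ l))

    coprimeWords : List (List Step)
    coprimeWords = filter coprimeω? (words l k)

    primitiveCircuits : List (List Bond)
    primitiveCircuits = map (uncurry walk) (cartesianProduct (allFin n) coprimeWords)

    primitiveCircuits-unique : Unique primitiveCircuits
    primitiveCircuits-unique = map-unique inj (Unique.cartesianProduct⁺ (Unique.allFin⁺ n)
      (Unique.filter⁺ coprimeω? (words-unique l k)))
      where
      inj : ∀ {x y} → x ∈ cartesianProduct (allFin n) coprimeWords → y ∈ cartesianProduct (allFin n) coprimeWords →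
        uncurry walk x ≡ uncurry walk y → x ≡ y
      inj {v , w} x∈ _ = walk-injective {{length≢0 {w = w} (proj₁ (∈-words⁻ l k
        (proj₁ (∈-filter⁻ coprimeω? (proj₂ (∈-cartesianProduct⁻ (allFin n) coprimeWords x∈))))))}}

    length-primitiveCircuits : + length primitiveCircuits ≡
      + n ℤ.* sumOver (words l k) (λ w → ⟦ coprime? (exponent w) ω ⟧)
    length-primitiveCircuits = begin
      + length primitiveCircuits
        ≡⟨ cong +_ (length-map (uncurry walk) (cartesianProduct (allFin n) coprimeWords)) ⟩
      + length (cartesianProduct (allFin n) coprimeWords)
        ≡⟨ cong +_ (length-cartesianProduct (allFin n) coprimeWords) ⟩
      + (length (allFin n) * length coprimeWords)
        ≡⟨ cong (λ m → + (m * length coprimeWords)) (length-tabulate {n = n} (λ v → v)) ⟩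
      + (n * length coprimeWords)                                 ≡⟨ ℤ.pos-* n (length coprimeWords) ⟩
      + n ℤ.* + length coprimeWords
        ≡⟨ cong (ℤ._*_ (+ n)) (length-filter coprimeω? (words l k)) ⟩
      + n ℤ.* sumOver (words l k) (λ w → ⟦ coprimeω? w ⟧)         ∎
      where open ≡-Reasoning

    ∈-primitiveCircuits⁻ : ∀ {c} → c ∈ primitiveCircuits → ∃[ p ] bonds {l} {k} p ≡ c
    ∈-primitiveCircuits⁻ c∈ with ∈-map⁻ (uncurry walk) c∈
    ... | (v , w) , vw∈ , refl with ∈-filter⁻ coprimeω? {xs = words l k} (proj₂ (∈-cartesianProduct⁻ (allFin n) coprimeWords vw∈))
    ... | w∈ , cop with ∈-words⁻ l k w∈
    ... | len , bs = record
      { bonds       = walk v w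
      ; isCircuit   = walk-isCircuit v w (divides ω (disp w∈))
      ; length≡l    = ≡.trans (length-walk v w) len
      ; bCount≡k    = ≡.trans (bCount-bWeight (walk v w)) (≡.trans (cong bWeight (map-step-walk v w)) bs)
      ; isPrimitive = coprime⇒isPrimitive v w {{length≢0 {w = w} len}} (disp w∈) cop
      } , refl

    ∈-primitiveCircuits⁺ : (p : PrimitiveCircuit l k) → bonds p ∈ primitiveCircuits
    ∈-primitiveCircuits⁺ p with isCircuit⇒walk (bonds p) {{length≢0 {w = bonds p} (length≡l p)}} (isCircuit p)
    ... | v , c≡walk = subst (_∈ primitiveCircuits) (sym c≡walk)
      (∈-map⁺ (uncurry walk) (∈-cartesianProduct⁺ (∈-allFin v) (∈-filter⁺ coprimeω? w∈
        (isPrimitive⇒coprime v w {{length≢0 {w = w} len}} (disp w∈) (subst IsPrimitive c≡walk (isPrimitive p))))))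
      where
      w = map step (bonds p)
      len : length w ≡ l
      len = ≡.trans (length-map step (bonds p)) (length≡l p)
      w∈ : w ∈ words l k
      w∈ = subst (w ∈_) (cong₂ words len (≡.trans (sym (bCount-bWeight (bonds p))) (bCount≡k p))) (∈-words⁺ w)

    rotated : ∀ i → PrimitiveCircuit l k → PrimitiveCircuit l k
    rotated i p = record
      { bonds       = rot^ i (bonds p)
      ; isCircuit   = rot^-isCircuit i (isCircuit p)
      ; length≡l    = ≡.trans (length-rot^ i (bonds p)) (length≡l p)
      ; bCount≡k    = ≡.trans (bCount-bWeight (rot^ i (bonds p))) (≡.trans (sum-map-step-rot^ bIndicator i (bonds p))
                        (≡.trans (sym (bCount-bWeight (bonds p))) (bCount≡k p)))
      ; isPrimitive = isPrimitive-∼ (rot^⇒∼ i (bonds p)) (isPrimitive p)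
      }

    -- Equality would give the period `j ∸ i` to the rotation by `i`, which is again a primitive
    -- circuit of length `l`.
    rotations-distinct : ∀ p {i j} → i < j → j < l → rot^ i (bonds p) ≢ rot^ j (bonds p)
    rotations-distinct p {i} {j} i<j j<l eq = isPrimitive⇒aperiodic {q = j ∸ i} (isCircuit q) (isPrimitive q)
      (m<n⇒0<n∸m i<j) (subst (j ∸ i <_) (sym (length≡l q)) (≤-<-trans (m∸n≤m j i) j<l)) (begin
      rot^ (j ∸ i) (rot^ i (bonds p))  ≡⟨ rot^-+ i (j ∸ i) (bonds p) ⟨
      rot^ (i + (j ∸ i)) (bonds p)     ≡⟨ cong (λ m → rot^ m (bonds p)) (m+[n∸m]≡n (<⇒≤ i<j)) ⟩
      rot^ j (bonds p)                 ≡⟨ eq ⟨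
      rot^ i (bonds p)                 ∎)
      where
      open ≡-Reasoning
      q = rotated i p

    orbit-size : ∀ {c} → c ∈ primitiveCircuits → length (filter (c ∼?_) primitiveCircuits) ≡ l
    orbit-size c∈ with ∈-primitiveCircuits⁻ c∈
    ... | p , refl = ≡.trans (↭-length orbit) (length-applyUpTo (λ i → rot^ i c) l)
      where
      c = bonds p
      to : ∀ {d} → d ∈ filter (c ∼?_) primitiveCircuits → d ∈ applyUpTo (λ i → rot^ i c) l
      to d∈ with ∼⇒rot^< {{length≢0 {w = c} (length≡l p)}} (proj₂ (∈-filter⁻ (c ∼?_) {xs = primitiveCircuits} d∈))
      ... | i , i< , refl = ∈-applyUpTo⁺ (λ i → rot^ i c) (subst (i <_) (length≡l p) i<)
      from : ∀ {d} → d ∈ applyUpTo (λ i → rot^ i c) l → d ∈ filter (c ∼?_) primitiveCircuits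
      from d∈ with ∈-applyUpTo⁻ (λ i → rot^ i c) d∈
      ... | i , _ , refl = ∈-filter⁺ (c ∼?_) (∈-primitiveCircuits⁺ (rotated i p)) (rot^⇒∼ i c)
      orbit : filter (c ∼?_) primitiveCircuits ↭ applyUpTo (λ i → rot^ i c) l
      orbit = unique-↭ (Unique.filter⁺ (c ∼?_) primitiveCircuits-unique)
        (Unique.applyUpTo⁺₁ (λ i → rot^ i c) l (rotations-distinct p)) to from

    primitiveOrbits : List (List Bond)
    primitiveOrbits = deduplicate _∼?_ primitiveCircuits

    primitiveOrbits-cardinality : HasCardinality (𝒫 n a b l k) (length primitiveOrbits)
    primitiveOrbits-cardinality = representatives⇒cardinality rotationDecSetoid bonds
      (deduplicate-! rotationDecSetoid primitiveCircuits)
      (λ p → SetoidMembershipₚ.∈-deduplicate⁺ rotationSetoid _∼?_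
        (λ z∼y x∼y → Setoid.trans rotationSetoid x∼y (Setoid.sym rotationSetoid z∼y))
        (Any.map (Setoid.reflexive rotationSetoid) (∈-primitiveCircuits⁺ p)))
      (λ c∈ → ∈-primitiveCircuits⁻ (∈-deduplicate⁻ _∼?_ primitiveCircuits c∈))

    length-primitiveOrbits : + length primitiveOrbits ℤ.* + l ≡
      + n ℤ.* sumOver (words l k) (λ w → ⟦ coprime? (exponent w) ω ⟧)
    length-primitiveOrbits = ≡.trans
      (length-deduplicate rotationDecSetoid primitiveCircuits l orbit-size) length-primitiveCircuits

-- Passage to rational numbers and conclusion

/1-* : ∀ N n l T .{{_ : NonZero l}} → N ℤ.* + l ≡ n ℤ.* T → N / 1 ≡ (n / l) ℚ.* (T / 1)
-- In unnormalised fractions nothing is reduced, and equality is cross-multiplication.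
/1-* N n l@(suc l-1) T eq = ℚ.toℚᵘ-injective (begin-equality
  ℚ.toℚᵘ (N / 1)                              ≃⟨ ℚ.toℚᵘ-fromℚᵘ (mkℚᵘ N 0) ⟩
  mkℚᵘ N 0                                    ≃⟨ *≡* cross ⟩
  mkℚᵘ n l-1 ℚᵘ.* mkℚᵘ T 0                    ≃⟨ ℚᵘ.*-cong (ℚ.toℚᵘ-fromℚᵘ (mkℚᵘ n l-1)) (ℚ.toℚᵘ-fromℚᵘ (mkℚᵘ T 0)) ⟨
  ℚ.toℚᵘ (n / l) ℚᵘ.* ℚ.toℚᵘ (T / 1)          ≃⟨ ℚ.toℚᵘ-homo-* (n / l) (T / 1) ⟨
  ℚ.toℚᵘ ((n / l) ℚ.* (T / 1))                ∎)
  where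
  open ℚᵘ.≤-Reasoning
  cross : N ℤ.* + (l * 1) ≡ (n ℤ.* T) ℤ.* 1ℤ
  cross = ≡.trans (cong (λ m → N ℤ.* + m) (*-identityʳ l)) (≡.trans eq (sym (ℤ.*-identityʳ _)))

mainTheorem16 : (n a b : ℕ) .{{_ : NonZero n}} →
    2 ≤ n → 0 < a → a < b → b < n →
    Connected n a b →
    (l k : ℕ) .{{_ : NonZero l}} → k ≤ l →
    (ω : ℤ) → + l ℤ.* + a ℤ.+ + k ℤ.* (+ b ℤ.- + a) ≡ ω ℤ.* + n →
    ∃[ N ] (HasCardinality (𝒫 n a b l k) N × + N / 1 ≡ (+ n / l) ℚ.* (orbitSum l k ω / 1))
mainTheorem16 n a b _ _ _ _ _ l k _ ω eq =
  length (primitiveOrbits n a b l k ℤ.∣ ω ∣ disp) ,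
  primitiveOrbits-cardinality n a b l k ℤ.∣ ω ∣ disp ,
  /1-* (+ length (primitiveOrbits n a b l k ℤ.∣ ω ∣ disp)) (+ n) l (orbitSum l k ω)
    (≡.trans (length-primitiveOrbits n a b l k ℤ.∣ ω ∣ disp) (cong (ℤ._*_ (+ n)) (sym (orbitSum≡count l k ω))))
  where
  disp : ∀ {w} → w ∈ words l k → displacement n a b w ≡ ℤ.∣ ω ∣ * n
  -- The displacement is a natural number, so taking absolute values replaces `ω` by its absolute
  -- value, the number that coprimality refers to.
  disp w∈ = ≡.trans (cong ℤ.∣_∣ (≡.trans (displacement-words n a b l k w∈) eq)) (ℤ.abs-* ω (+ n))
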